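{- Let $r\geq 2$ and $n>r^{8}$. Every graph $G$ of order $n$ with $e(G)\geq t_{r}(n)$ satisfies \[ js^{(2,r+1,2)}(G)>\frac{n^{r-1}}{r^{r+5}} \] unless $G=T_{r}(n)$.
   Context: All graphs are finite and simple; $e(G)$ is the number of edges. $T_{r}(n)$ is the Turán graph: the complete $r$-partite graph on $n$ vertices whose part sizes differ by at most one; $t_{r}(n)=e(T_{r}(n))$. For a graph $G$, $js^{(2,r+1,2)}(G)$ is the maximum, over all edges $uv$ of $G$, of the number of $(r+1)$-cliques of $G$ containing both $u$ and $v$ (and $0$ if $G$ has no edges). -}

module Defs where

open import Data.Nat using (ℕ; zero; suc; _+_; _*_; _⊔_; _%_; _<?_; NonZero)
open import Data.Bool using (Bool; true; false; _∧_; _∨_; not)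
open import Data.Fin using (Fin; toℕ)
open import Data.Fin.Properties using () renaming (_≟_ to _≟ᶠ_)
open import Data.Nat.Properties using () renaming (_≟_ to _≟ℕ_)
open import Data.Vec using (Vec; []; _∷_; lookup)
open import Data.List using (List; []; _∷_; map; concatMap; allFin; length; filter; foldr; _++_)
open import Data.Product using (_×_; _,_; Σ)
open import Data.Fin.Subset using (Subset; ∣_∣)
open import Relation.Nullary.Decidable using (⌊_⌋)
open import Relation.Binary.PropositionalEquality using (_≡_)
open import Function.Bundles using (_↔_; Inverse)

record Graph (n : ℕ) : Set where
  field
    adj     : Fin n → Fin n → Bool
    adj-sym : ∀ i j → adj i j ≡ adj j i
    adj-irr : ∀ i → adj i i ≡ false
open Graph public

pairs : (n : ℕ) → List (Fin n × Fin n)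
pairs n = concatMap (λ i → map (λ j → (i , j))
                       (filter (λ j → toℕ i <? toℕ j) (allFin n)))
                    (allFin n)

edges : ∀ {n} → Graph n → List (Fin n × Fin n)
edges {n} G = filter (λ p → Data.Bool._≟_ (adj G (Data.Product.proj₁ p) (Data.Product.proj₂ p)) true) (pairs n)
  where import Data.Bool; import Data.Product

e : ∀ {n} → Graph n → ℕ
e G = length (edges G)

allSubsets : (n : ℕ) → List (Subset n)
allSubsets zero    = [] ∷ []
allSubsets (suc n) = map (true ∷_) (allSubsets n) ++ map (false ∷_) (allSubsets n)

isCliqueB : ∀ {n} → Graph n → Subset n → Bool
isCliqueB {n} G S =
  Data.Bool.ListAction.and (map (λ p → not (lookup S (Data.Product.proj₁ p) ∧ lookup S (Data.Product.proj₂ p))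
                             ∨ adj G (Data.Product.proj₁ p) (Data.Product.proj₂ p))
                     (pairs n))
  where import Data.Bool.ListAction; import Data.Product

cliquesThrough : ∀ {n} → Graph n → ℕ → Fin n → Fin n → ℕ
cliquesThrough {n} G k u v =
  length (filter (λ S → Data.Bool._≟_
                     (⌊ ∣ S ∣ ≟ℕ k ⌋ ∧ lookup S u ∧ lookup S v ∧ isCliqueB G S) true)
                 (allSubsets n))
  where import Data.Bool

-- js^{(2,r+1,2)}(G): max over edges uv of the number of (r+1)-cliques
-- containing u and v; 0 if G has no edges
js : ∀ {n} → ℕ → Graph n → ℕ
js r G = foldr (λ p m → cliquesThrough G (suc r) (Data.Product.proj₁ p) (Data.Product.proj₂ p) ⊔ m)
               0 (edges G)
  where import Data.Product

-- Turán graph T_r(n) on Fin n: vertex i lies in part (i mod r);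
-- parts have sizes differing by at most one; adjacent iff different parts.
turán : (r : ℕ) .{{_ : NonZero r}} (n : ℕ) → Graph n
turán r n = record
  { adj     = λ i j → not ⌊ (toℕ i % r) ≟ℕ (toℕ j % r) ⌋
  ; adj-sym = sym'
  ; adj-irr = irr
  }
  where
  open import Relation.Binary.PropositionalEquality using (refl; sym)
  open import Relation.Nullary using (yes; no)
  sym' : ∀ i j → not ⌊ (toℕ i % r) ≟ℕ (toℕ j % r) ⌋ ≡ not ⌊ (toℕ j % r) ≟ℕ (toℕ i % r) ⌋
  sym' i j with (toℕ i % r) ≟ℕ (toℕ j % r) | (toℕ j % r) ≟ℕ (toℕ i % r)
  ... | yes _ | yes _ = refl
  ... | no _  | no _  = refl
  ... | yes p | no q  = Data.Empty.⊥-elim (q (sym p)) where import Data.Empty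
  ... | no p  | yes q = Data.Empty.⊥-elim (p (sym q)) where import Data.Empty
  irr : ∀ i → not ⌊ (toℕ i % r) ≟ℕ (toℕ i % r) ⌋ ≡ false
  irr i with (toℕ i % r) ≟ℕ (toℕ i % r)
  ... | yes _ = refl
  ... | no q  = Data.Empty.⊥-elim (q refl) where import Data.Empty

t : (r : ℕ) .{{_ : NonZero r}} (n : ℕ) → ℕ
t r n = e (turán r n)

_≅_ : ∀ {n} → Graph n → Graph n → Set
_≅_ {n} G H = Σ (Fin n ↔ Fin n) λ σ →
  ∀ i j → adj G (Inverse.to σ i) (Inverse.to σ j) ≡ adj H i j

{-# OPTIONS --safe #-}
module Submission where

-- Write τ(m) for the number of ordered pairs in a common part of T_r(m), D(P) for the number of
-- ordered nonadjacent pairs (x, x included) in a vertex set P, and put k ≈ n / r⁴. Starting from the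
-- whole vertex set, delete vertices with more than (m − 1) / r + k non-neighbours, m being the
-- current size; this maintains D(P) + 2 i k ≤ τ(m) after i deletions.
--
-- If i = r² k is reached, P has so many edges that the Moon–Moser inequalities give enough
-- (r+1)-cliques for an average edge to lie in many of them. Otherwise the process stops at a set P
-- of large minimum degree. If P contains an (r+1)-clique, averaging over its pairs gives an edge uv
-- with more than (1 − 2 / r) m common neighbours, by a margin that lets a greedy extension of uv
-- survive its last step. If P contains none, Erdős's degree majorisation gives τ(m) ≤ D(P), so no
-- vertex was deleted, equality holds throughout, and the graph is T_r(n).

open import Defs
open import Data.Bool using (Bool; true; false; _∧_; _∨_; not; if_then_else_)
open import Data.Bool.ListAction using (and)
open import Data.Bool.Properties using (∧-assoc; ∧-comm; ∧-identityʳ; not-involutive) renaming (_≟_ to _≟ᵇ_)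
open import Data.Empty using (⊥; ⊥-elim)
open import Data.Fin using (Fin; zero; suc; toℕ; fromℕ<; punchOut)
open import Data.Fin.Properties using (any?; all?; toℕ-injective; toℕ<n; toℕ-fromℕ<; punchOut-injective; injective⇒≤) renaming (_≟_ to _≟ᶠ_)
open import Data.Fin.Subset using (Subset; ∣_∣) renaming (⊥ to ∅)
open import Data.Fin.Subset.Properties using (∣⊥∣≡0)
open import Data.List using (List; []; _∷_; length; map; concatMap; allFin; filter; foldr; tabulate) renaming (_++_ to _++ˡ_)
open import Data.List.Membership.Propositional using (_∈_)
open import Data.List.Membership.Propositional.Properties using (∈-concatMap⁺; ∈-concatMap⁻; ∈-map⁺; ∈-map⁻; ∈-filter⁺; ∈-filter⁻; ∈-allFin)
open import Data.List.Relation.Unary.Any using (Any; here; there)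
open import Data.Nat
open import Data.Nat.DivMod
open import Data.Nat.Properties
open import Data.Nat.Tactic.RingSolver using (solve-∀)
open import Data.Product using (_×_; _,_; proj₁; proj₂; ∃; ∃-syntax)
open import Data.Sum using (_⊎_; inj₁; inj₂)
open import Data.Unit using (⊤; tt)
open import Data.Vec using ([]; _∷_; lookup; _[_]≔_)
open import Data.Vec.Properties using (lookup∘update; lookup∘update′; lookup-replicate)
open import Function using (_∘_)
open import Function.Bundles using (mk↔ₛ′)
open import Function.Definitions using (Injective)
open import Relation.Binary.Definitions using (tri<; tri≈; tri>)
open import Relation.Binary.PropositionalEquality hiding (J)
open import Relation.Nullary
open import Relation.Nullary.Decidable using (⌊_⌋; _×-dec_; _→-dec_; ¬?)
open import Relation.Unary using (Decidable)

import Algebra.Properties.Semiring.Sum +-*-semiring as Sum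

-- A vertex of low degree can ruin a greedy extension although the edge count is extremal, which is
-- why vertices are deleted first; each deletion is charged so that `D` falls behind `τ` by another
-- 2 k. The scale k ≈ n / r⁴ is squeezed from both sides. The greedy count through the dense edge is
-- proportional to k and must exceed n ^ (r - 1) / r ^ (r + 5); after a factor 2 for passing from n
-- to m and a factor r - 1 = (r - 1)! / (r - 2)!, this is `greedy-margin`. On the other side, a
-- degree defect of order k must not spoil the averaging over the pairs of a clique: that is
-- `slack-bound`, an equality at r = 2. The cap r² k on deletions is small enough for `double-loss`
-- and `slack-bound`, and large enough for the accumulated deficit to pass `excess-margin`. Cliques
-- are counted as ordered tuples and divisions are cleared, so that the estimates stay within the
-- naturals.

-- Linear arithmetic, finite sums and sums over Boolean vertex sets.

-- Replaces subtraction: `x ≤ y` is a weighted sum of known inequalities, and the second premise is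
-- then usually an identity for the ring solver. With `x = 0`, `y` is an explicit surplus.
cancel-≤ : ∀ {a b x y} → x ≤ y → a + y ≤ b + x → a ≤ b
cancel-≤ {a} {b} {x} {y} x≤y h = +-cancelʳ-≤ y a b (≤-trans h (+-monoʳ-≤ b x≤y))

-- Opaque, so that unification can treat a sum as a rigid head.
opaque
  sum : ∀ {n} → (Fin n → ℕ) → ℕ
  sum = Sum.sum

  sum-zero : (f : Fin 0 → ℕ) → sum f ≡ 0
  sum-zero f = refl

  sum-suc : ∀ {n} (f : Fin (suc n) → ℕ) → sum f ≡ f zero + sum (f ∘ suc)
  sum-suc f = refl

  sum-cong : ∀ {n} {f g : Fin n → ℕ} → f ≗ g → sum f ≡ sum g
  sum-cong = Sum.sum-cong-≗

  sum-+ : ∀ {n} (f g : Fin n → ℕ) → sum (λ i → f i + g i) ≡ sum f + sum g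
  sum-+ = Sum.∑-distrib-+

  sum-swap : ∀ {m n} (f : Fin m → Fin n → ℕ) → sum (λ i → sum (f i)) ≡ sum (λ j → sum (λ i → f i j))
  sum-swap = Sum.∑-comm

  sum-*ˡ : ∀ {n} c (f : Fin n → ℕ) → c * sum f ≡ sum (λ i → c * f i)
  sum-*ˡ = Sum.*-distribˡ-sum

  sum-mono : ∀ {n} {f g : Fin n → ℕ} → (∀ i → f i ≤ g i) → sum f ≤ sum g
  sum-mono {zero}  h = z≤n
  sum-mono {suc n} h = +-mono-≤ (h zero) (sum-mono (h ∘ suc))

  term≤sum : ∀ {n} (f : Fin n → ℕ) i → f i ≤ sum f
  term≤sum f zero    = m≤m+n _ _
  term≤sum f (suc i) = ≤-trans (term≤sum (f ∘ suc) i) (m≤n+m _ _)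

  -- No term can have slack, since the other terms could not win it back. The equality cases of the
  -- extremal argument rest on this.
  sum-squeeze : ∀ {n} (f g : Fin n → ℕ) → (∀ i → f i ≤ g i) → sum g ≤ sum f → ∀ i → f i ≡ g i
  sum-squeeze f g f≤g h zero = ≤-antisym (f≤g zero)
    (+-cancelʳ-≤ (sum (f ∘ suc)) _ _ (≤-trans (+-monoʳ-≤ (g zero) (sum-mono (f≤g ∘ suc))) h))
  sum-squeeze f g f≤g h (suc i) = sum-squeeze (f ∘ suc) (g ∘ suc) (f≤g ∘ suc)
    (+-cancelˡ-≤ (f zero) _ _ (≤-trans (+-monoˡ-≤ _ (f≤g zero)) h)) i

  sum-pos : ∀ {n} (f : Fin n → ℕ) → 0 < sum f → ∃ λ i → 0 < f i
  sum-pos {suc n} f h with f zero in eq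
  ... | suc _ = zero , subst (0 <_) (sym eq) z<s
  ... | zero  with sum-pos (f ∘ suc) h
  ...   | i , p = suc i , p

  sum-const : ∀ n c → sum {n} (λ _ → c) ≡ n * c
  sum-const zero    c = refl
  sum-const (suc n) c = cong (c +_) (sum-const n c)

sum-*ʳ : ∀ {n} c (f : Fin n → ℕ) → sum f * c ≡ sum (λ i → f i * c)
sum-*ʳ c f = trans (*-comm (sum f) c) (trans (sum-*ˡ c f) (sum-cong λ i → *-comm c (f i)))

⟦_⟧ : Bool → ℕ
⟦ true  ⟧ = 1
⟦ false ⟧ = 0

⟦⟧≤1 : ∀ b → ⟦ b ⟧ ≤ 1
⟦⟧≤1 true  = ≤-refl
⟦⟧≤1 false = z≤n

⟦∧⟧ : ∀ a b → ⟦ a ∧ b ⟧ ≡ ⟦ a ⟧ * ⟦ b ⟧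
⟦∧⟧ true  b = sym (*-identityˡ ⟦ b ⟧)
⟦∧⟧ false b = refl

Pred : ℕ → Set
Pred n = Fin n → Bool

_∩_ : ∀ {n} → Pred n → Pred n → Pred n
(P ∩ Q) x = P x ∧ Q x

# : ∀ {n} → Pred n → ℕ
# P = sum (λ x → ⟦ P x ⟧)

sumOn : ∀ {n} → Pred n → (Fin n → ℕ) → ℕ
sumOn P f = sum (λ x → ⟦ P x ⟧ * f x)

#-cong : ∀ {n} {P Q : Pred n} → P ≗ Q → # P ≡ # Q
#-cong h = sum-cong (cong ⟦_⟧ ∘ h)

#-sumOn : ∀ {n} (P : Pred n) → # P ≡ sumOn P (λ _ → 1)
#-sumOn P = sum-cong λ x → sym (*-identityʳ ⟦ P x ⟧)

sumOn-cong : ∀ {n} (P : Pred n) {f g : Fin n → ℕ} → f ≗ g → sumOn P f ≡ sumOn P g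
sumOn-cong P h = sum-cong λ x → cong (⟦ P x ⟧ *_) (h x)

sumOn-mono : ∀ {n} (P : Pred n) {f g : Fin n → ℕ} → (∀ x → P x ≡ true → f x ≤ g x) → sumOn P f ≤ sumOn P g
sumOn-mono P {f} {g} h = sum-mono pt
  where
  pt : ∀ x → ⟦ P x ⟧ * f x ≤ ⟦ P x ⟧ * g x
  pt x with P x in eq
  ... | true  = *-monoʳ-≤ 1 (h x eq)
  ... | false = z≤n

sumOn-+ : ∀ {n} (P : Pred n) (f g : Fin n → ℕ) → sumOn P (λ x → f x + g x) ≡ sumOn P f + sumOn P g
sumOn-+ P f g = trans (sum-cong λ x → *-distribˡ-+ ⟦ P x ⟧ (f x) (g x)) (sum-+ _ _)

sumOn-* : ∀ {n} (P : Pred n) c (f : Fin n → ℕ) → sumOn P (λ x → c * f x) ≡ c * sumOn P f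
sumOn-* P c f = trans (sum-cong λ x → swap ⟦ P x ⟧ c (f x)) (sym (sum-*ˡ c (λ x → ⟦ P x ⟧ * f x)))
  where
  swap : ∀ a b d → a * (b * d) ≡ b * (a * d)
  swap = solve-∀

sumOn-*ʳ : ∀ {n} (P : Pred n) c (f : Fin n → ℕ) → sumOn P (λ x → f x * c) ≡ sumOn P f * c
sumOn-*ʳ P c f = trans (sumOn-cong P λ x → *-comm (f x) c) (trans (sumOn-* P c f) (*-comm c _))

sumOn-const : ∀ {n} (P : Pred n) c → sumOn P (λ _ → c) ≡ # P * c
sumOn-const P c = sym (sum-*ʳ c (λ x → ⟦ P x ⟧))

-- Ordered cliques and the Moon-Moser inequalities.

module Cliques {n : ℕ} (G : Graph n) where

  N : Fin n → Pred n
  N = adj G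

  -- Sums `F` over the ordered k-cliques inside `P`. Order makes the neighbourhood of the first
  -- vertex carry the recursion; the factor k! is settled in `cl≤unordered`.
  tup : ℕ → Pred n → (List (Fin n) → ℕ) → ℕ
  tup zero    P F = F []
  tup (suc k) P F = sumOn P (λ x → tup k (P ∩ N x) (λ K → F (x ∷ K)))

  cl : ℕ → Pred n → ℕ
  cl k P = tup k P (λ _ → 1)

  tup-cong : ∀ k {P Q F F′} → P ≗ Q → (∀ K → F K ≡ F′ K) → tup k P F ≡ tup k Q F′
  tup-cong zero    PQ FF = FF []
  tup-cong (suc k) PQ FF = sum-cong λ x → cong₂ _*_ (cong ⟦_⟧ (PQ x))
    (tup-cong k (λ y → cong (_∧ N x y) (PQ y)) (λ K → FF (x ∷ K)))

  tup-mono : ∀ k P {F F′} → (∀ K → F K ≤ F′ K) → tup k P F ≤ tup k P F′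
  tup-mono zero    P h = h []
  tup-mono (suc k) P h = sumOn-mono P λ x _ → tup-mono k (P ∩ N x) (λ K → h (x ∷ K))

  tup-+ : ∀ k P F F′ → tup k P (λ K → F K + F′ K) ≡ tup k P F + tup k P F′
  tup-+ zero    P F F′ = refl
  tup-+ (suc k) P F F′ = trans (sumOn-cong P λ x → tup-+ k (P ∩ N x) _ _) (sumOn-+ P _ _)

  tup-* : ∀ k P c F → tup k P (λ K → c * F K) ≡ c * tup k P F
  tup-* zero    P c F = refl
  tup-* (suc k) P c F = trans (sumOn-cong P λ x → tup-* k (P ∩ N x) c _) (sumOn-* P c _)

  cl-cong : ∀ k {P Q} → P ≗ Q → cl k P ≡ cl k Q
  cl-cong k h = tup-cong k h (λ _ → refl)

  cl-one : ∀ P → cl 1 P ≡ # P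
  cl-one P = sym (#-sumOn P)

  ⊆-∩ : ∀ {P Q : Pred n} x → (∀ y → P y ≡ true → Q y ≡ true) → ∀ y → (P ∩ N x) y ≡ true → (Q ∩ N x) y ≡ true
  ⊆-∩ {P} x h y with P y in eq
  ... | true  = λ e → trans (cong (_∧ N x y) (h y eq)) e
  ... | false = λ ()

  cl-mono : ∀ k {P Q} → (∀ x → P x ≡ true → Q x ≡ true) → cl k P ≤ cl k Q
  cl-mono zero    h = ≤-refl
  cl-mono (suc k) {P} {Q} h = sum-mono pt
    where
    pt : ∀ x → ⟦ P x ⟧ * cl k (P ∩ N x) ≤ ⟦ Q x ⟧ * cl k (Q ∩ N x)
    pt x with P x in eq
    ... | true rewrite h x eq = *-monoʳ-≤ 1 (cl-mono k (⊆-∩ x h))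
    ... | false = z≤n

  joined : List (Fin n) → Pred n
  joined []      x = true
  joined (d ∷ K) x = N d x ∧ joined K x

  private
    swap-coeff : ∀ a b e e′ t → e ≡ e′ → ⟦ a ⟧ * (⟦ b ∧ e ⟧ * t) ≡ ⟦ b ⟧ * (⟦ a ∧ e′ ⟧ * t)
    swap-coeff true  true  e e′ t refl = refl
    swap-coeff true  false e e′ t refl = refl
    swap-coeff false true  e e′ t refl = refl
    swap-coeff false false e e′ t refl = refl

    swap-∧ : ∀ a b c → (a ∧ b) ∧ c ≡ (a ∧ c) ∧ b
    swap-∧ a b c = trans (∧-assoc a b c) (trans (cong (a ∧_) (∧-comm b c)) (sym (∧-assoc a c b)))

  -- Both sides run over ordered cliques, with `x` chosen before or after `K`. The induction moves
  -- `x` past the head of `K`, by symmetry of adjacency.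
  tup-fubini : ∀ k P (H : Fin n → List (Fin n) → ℕ) →
    sumOn P (λ x → tup k (P ∩ N x) (H x)) ≡ tup k P (λ K → sumOn (P ∩ joined K) (λ x → H x K))
  tup-fubini zero    P H = sum-cong λ x → cong (λ b → ⟦ b ⟧ * H x []) (sym (∧-identityʳ (P x)))
  tup-fubini (suc k) P H = begin
    sum (λ x → ⟦ P x ⟧ * sum (λ z → ⟦ P z ∧ N x z ⟧ * T x z))
      ≡⟨ sum-cong (λ x → sum-*ˡ ⟦ P x ⟧ _) ⟩
    sum (λ x → sum (λ z → ⟦ P x ⟧ * (⟦ P z ∧ N x z ⟧ * T x z)))
      ≡⟨ sum-swap (λ x z → ⟦ P x ⟧ * (⟦ P z ∧ N x z ⟧ * T x z)) ⟩
    sum (λ z → sum (λ x → ⟦ P x ⟧ * (⟦ P z ∧ N x z ⟧ * T x z)))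
      ≡⟨ sum-cong (λ z → sum-cong (λ x → trans
           (cong (λ t → ⟦ P x ⟧ * (⟦ P z ∧ N x z ⟧ * t)) (tup-cong k (λ y → swap-∧ (P y) (N x y) (N z y)) (λ _ → refl)))
           (swap-coeff (P x) (P z) _ _ (T′ z x) (adj-sym G x z)))) ⟩
    sum (λ z → sum (λ x → ⟦ P z ⟧ * (⟦ P x ∧ N z x ⟧ * T′ z x)))
      ≡⟨ sum-cong (λ z → sym (sum-*ˡ ⟦ P z ⟧ _)) ⟩
    sumOn P (λ z → sumOn (P ∩ N z) (T′ z))
      ≡⟨ sumOn-cong P (λ z → tup-fubini k (P ∩ N z) (λ x K → H x (z ∷ K))) ⟩
    sumOn P (λ z → tup k (P ∩ N z) (λ K → sumOn ((P ∩ N z) ∩ joined K) (λ x → H x (z ∷ K))))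
      ≡⟨ sumOn-cong P (λ z → tup-cong k (λ _ → refl) (λ K → sum-cong (λ x → cong (λ b → ⟦ b ⟧ * H x (z ∷ K)) (∧-assoc (P x) (N z x) (joined K x))))) ⟩
    tup (suc k) P (λ K → sumOn (P ∩ joined K) (λ x → H x K)) ∎
    where
    open ≡-Reasoning
    T T′ : Fin n → Fin n → ℕ
    T x z  = tup k ((P ∩ N x) ∩ N z) (λ K → H x (z ∷ K))
    T′ z x = tup k ((P ∩ N z) ∩ N x) (λ K → H x (z ∷ K))

  ext : Pred n → List (Fin n) → ℕ
  ext P K = # (P ∩ joined K)

  ext-link : ∀ P x K → ext (P ∩ N x) K ≡ ext P (x ∷ K)
  ext-link P x K = #-cong λ y → ∧-assoc (P y) (N x y) (joined K y)

  cl-suc : ∀ k P → cl (suc k) P ≡ tup k P (ext P)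
  cl-suc k P = trans (tup-fubini k P (λ _ _ → 1)) (tup-cong k (λ _ → refl) (λ K → sym (#-sumOn (P ∩ joined K))))

  -- The second moment of clique degrees, which links three consecutive clique counts.
  Q : ℕ → Pred n → ℕ
  Q k P = tup k P (λ K → ext P K * ext P K)

  -- A vertex y joined to K or to x contributes at most 1 + [y joined to both].
  private
    incl-excl : ∀ p a b → ⟦ p ∧ a ⟧ + ⟦ p ∧ b ⟧ ≤ ⟦ p ⟧ + ⟦ (p ∧ b) ∧ a ⟧
    incl-excl true  true  true  = ≤-refl
    incl-excl true  true  false = ≤-refl
    incl-excl true  false true  = ≤-refl
    incl-excl true  false false = z≤n
    incl-excl false a     b     = z≤n

  -- Sum `incl-excl` over all ordered cliques `K` and vertices `x` joined to `K`, then exchange the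
  -- sums. The sum over `x` on the left is the term that the induction hypothesis of `moon-moser`
  -- leaves in the links.
  Q-step : ∀ k P →
    Q k P + sumOn P (λ x → # (P ∩ N x) * cl k (P ∩ N x)) ≤ # P * cl (suc k) P + cl (suc (suc k)) P
  Q-step k P = begin
    Q k P + sumOn P (λ x → # (P ∩ N x) * cl k (P ∩ N x))
      ≡⟨ cong₂ _+_ (tup-cong k (λ _ → refl) (λ K → sym (sumOn-const (P ∩ joined K) (ext P K))))
           (trans (sumOn-cong P (λ x → trans (sym (tup-* k (P ∩ N x) (# (P ∩ N x)) (λ _ → 1))) (tup-cong k (λ _ → refl) (λ K → *-identityʳ _))))
                  (tup-fubini k P (λ x _ → # (P ∩ N x)))) ⟩
    tup k P (λ K → sumOn (P ∩ joined K) (λ _ → ext P K)) + tup k P (λ K → sumOn (P ∩ joined K) (λ x → # (P ∩ N x)))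
      ≡⟨ sym (tup-+ k P _ _) ⟩
    tup k P (λ K → sumOn (P ∩ joined K) (λ _ → ext P K) + sumOn (P ∩ joined K) (λ x → # (P ∩ N x)))
      ≤⟨ tup-mono k P pointwise ⟩
    tup k P (λ K → # P * ext P K + sumOn (P ∩ joined K) (λ x → ext (P ∩ N x) K))
      ≡⟨ tup-+ k P _ _ ⟩
    tup k P (λ K → # P * ext P K) + tup k P (λ K → sumOn (P ∩ joined K) (λ x → ext (P ∩ N x) K))
      ≡⟨ cong₂ _+_ (trans (tup-* k P (# P) (ext P)) (cong (# P *_) (sym (cl-suc k P))))
           (trans (sym (tup-fubini k P (λ x K → ext (P ∩ N x) K))) (sumOn-cong P (λ x → sym (cl-suc k (P ∩ N x))))) ⟩
    # P * cl (suc k) P + cl (suc (suc k)) P ∎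
    where
    open ≤-Reasoning
    pointwise : ∀ K → sumOn (P ∩ joined K) (λ _ → ext P K) + sumOn (P ∩ joined K) (λ x → # (P ∩ N x))
                    ≤ # P * ext P K + sumOn (P ∩ joined K) (λ x → ext (P ∩ N x) K)
    pointwise K = begin
      sumOn R (λ _ → ext P K) + sumOn R (λ x → # (P ∩ N x))
        ≡⟨ sym (sumOn-+ R _ _) ⟩
      sumOn R (λ x → ext P K + # (P ∩ N x))
        ≤⟨ sumOn-mono R (λ x _ → subst₂ _≤_ (sum-+ _ _) (sum-+ _ _)
             (sum-mono (λ y → incl-excl (P y) (joined K y) (N x y)))) ⟩
      sumOn R (λ x → # P + ext (P ∩ N x) K)
        ≡⟨ sumOn-+ R _ _ ⟩
      sumOn R (λ _ → # P) + sumOn R (λ x → ext (P ∩ N x) K)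
        ≡⟨ cong (_+ sumOn R (λ x → ext (P ∩ N x) K)) (trans (sumOn-const R (# P)) (*-comm (ext P K) (# P))) ⟩
      # P * ext P K + sumOn R (λ x → ext (P ∩ N x) K) ∎
      where R = P ∩ joined K

  -- `Q (suc k) P` is the sum of `Q k` over the links `P ∩ N x`. To `suc k` copies of it the
  -- induction hypothesis applies; the remaining copy goes to `Q-step`, which absorbs the
  -- degree-weighted sum that arises.
  moon-moser : ∀ k P → suc k * Q k P ≤ # P * cl (suc k) P + k * cl (suc (suc k)) P
  moon-moser zero P = ≤-reflexive (begin
    1 * (# (P ∩ joined []) * # (P ∩ joined []))
      ≡⟨ *-identityˡ _ ⟩
    # (P ∩ joined []) * # (P ∩ joined [])
      ≡⟨ cong₂ _*_ (#-cong (λ x → ∧-identityʳ (P x))) (trans (#-cong (λ x → ∧-identityʳ (P x))) (sym (cl-one P))) ⟩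
    # P * cl 1 P
      ≡⟨ sym (+-identityʳ _) ⟩
    # P * cl 1 P + 0 ∎)
    where open ≡-Reasoning
  moon-moser (suc k) P = begin
    Q (suc k) P + suc k * Q (suc k) P
      ≡⟨ cong (Q (suc k) P +_) (trans (cong (suc k *_) links) (sym (sumOn-* P (suc k) _))) ⟩
    Q (suc k) P + sumOn P (λ x → suc k * Q k (P ∩ N x))
      ≤⟨ +-monoʳ-≤ (Q (suc k) P) (sumOn-mono P (λ x _ → moon-moser k (P ∩ N x))) ⟩
    Q (suc k) P + sumOn P (λ x → # (P ∩ N x) * cl (suc k) (P ∩ N x) + k * cl (suc (suc k)) (P ∩ N x))
      ≡⟨ cong (Q (suc k) P +_) (trans (sumOn-+ P _ _) (cong (S +_) (sumOn-* P k _))) ⟩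
    Q (suc k) P + (S + k * Y)
      ≡⟨ sym (+-assoc (Q (suc k) P) S (k * Y)) ⟩
    (Q (suc k) P + S) + k * Y
      ≤⟨ +-monoˡ-≤ (k * Y) (Q-step (suc k) P) ⟩
    (# P * cl (suc (suc k)) P + Y) + k * Y
      ≡⟨ +-assoc _ Y (k * Y) ⟩
    # P * cl (suc (suc k)) P + suc k * Y ∎
    where
    open ≤-Reasoning
    Y = cl (suc (suc (suc k))) P
    S = sumOn P (λ x → # (P ∩ N x) * cl (suc k) (P ∩ N x))
    links : Q (suc k) P ≡ sumOn P (λ x → Q k (P ∩ N x))
    links = sumOn-cong P λ x → tup-cong k (λ _ → refl) λ K → cong (λ t → t * t) (sym (ext-link P x K))

-- Elementary inequalities behind class sizes and clique densities.

-- (a − q)(a − q − 1) ≥ 0 over the integers.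
consecutive-gap : ∀ q a → (q + q + 1) * a ≤ a * a + q * (q + 1)
consecutive-gap zero    zero    = z≤n
consecutive-gap zero    (suc a) = cancel-≤ {x = 0} {y = a + a * a} z≤n (≤-reflexive (id a))
  where
  id : ∀ a → (0 + 0 + 1) * suc a + (a + a * a) ≡ suc a * suc a + 0 * (0 + 1) + 0
  id = solve-∀
consecutive-gap (suc q) zero    = ≤-trans (≤-reflexive (*-zeroʳ (suc q + suc q + 1))) z≤n
consecutive-gap (suc q) (suc a) = cancel-≤ (consecutive-gap q a) (≤-reflexive (id q a))
  where
  id : ∀ q a → (suc q + suc q + 1) * suc a + (a * a + q * (q + 1)) ≡ suc a * suc a + suc q * (suc q + 1) + (q + q + 1) * a
  id = solve-∀

-- A product of consecutive integers vanishes only at its two roots; this is what balances the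
-- colour classes of an extremal graph.
consecutive-gap-eq : ∀ q a → a * a + q * (q + 1) ≡ (q + q + 1) * a → a ≡ q ⊎ a ≡ suc q
consecutive-gap-eq zero    zero    h = inj₁ refl
consecutive-gap-eq zero    (suc zero) h = inj₂ refl
consecutive-gap-eq zero    (suc (suc a)) h = ⊥-elim (m+1+n≢m _ (trans (sym (id a)) h))
  where
  id : ∀ a → suc (suc a) * suc (suc a) + 0 * (0 + 1) ≡ (0 + 0 + 1) * suc (suc a) + suc (1 + 3 * a + a * a)
  id = solve-∀
consecutive-gap-eq (suc q) zero    h = ⊥-elim (1+n≢0 {q + suc q * suc q} (trans (sym (id q)) (trans h (*-zeroʳ (suc q + suc q + 1)))))
  where
  id : ∀ q → 0 * 0 + suc q * (suc q + 1) ≡ suc (q + suc q * suc q)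
  id = solve-∀
consecutive-gap-eq (suc q) (suc a) h with consecutive-gap-eq q a (+-cancelʳ-≡ (2 * (a + q) + 3) _ _ (trans (id₁ q a) (trans h (id₂ q a))))
  where
  id₁ : ∀ q a → a * a + q * (q + 1) + (2 * (a + q) + 3) ≡ suc a * suc a + suc q * (suc q + 1)
  id₁ = solve-∀
  id₂ : ∀ q a → (suc q + suc q + 1) * suc a ≡ (q + q + 1) * a + (2 * (a + q) + 3)
  id₂ = solve-∀
... | inj₁ e = inj₁ (cong suc e)
... | inj₂ e = inj₂ (cong suc e)

two-products : ∀ a b → 2 * (a * b) ≤ a * a + b * b
two-products zero    b       = z≤n
two-products (suc a) zero    = ≤-trans (≤-reflexive (cong (2 *_) (*-zeroʳ (suc a)))) z≤n
two-products (suc a) (suc b) = cancel-≤ (two-products a b) (≤-reflexive (id a b))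
  where
  id : ∀ a b → 2 * (suc a * suc b) + (a * a + b * b) ≡ suc a * suc a + suc b * suc b + 2 * (a * b)
  id = solve-∀

-- C, X, Y stand for the numbers of (k+1)-, (k+2)- and (k+3)-cliques, and q for the second moment
-- of the degrees of the (k+1)-cliques.
density-step : ∀ k m D C X Y q →
  m * m * C ≤ m * X + suc k * D * C →
  suc (suc k) * q ≤ m * X + suc k * Y →
  (∀ M → 2 * (m * M * X) ≤ m * m * q + M * M * C) →
  m * m * X ≤ m * Y + suc (suc k) * D * X
density-step k zero D C X Y q hC hq cs = z≤n
density-step k m@(suc _) D C X Y q hC hq cs with ≤-total (suc k * D) (m * m)
... | inj₂ le = ≤-trans (*-monoˡ-≤ X le) (≤-trans (*-monoˡ-≤ X (*-monoˡ-≤ D (n≤1+n (suc k)))) (m≤n+m _ (m * Y)))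
... | inj₁ le with m≤n⇒∃[o]m+o≡n le
-- `M` is m² - (k + 1) D; a negative value was the trivial case. Then M C ≤ m X, and `cs` taken at
-- this `M` yields M X ≤ m q.
...   | M , eM = *-cancelˡ-≤ (suc k) (cancel-≤ s4 (≤-reflexive
            (trans (id₃ k m X Y) id₄)))
  where
  s1 : M * C ≤ m * X
  s1 = cancel-≤ hC (≤-reflexive (trans (id M C m X (suc k * D)) (cong (λ t → m * X + t * C) eM)))
    where
    id : ∀ M C m X u → M * C + (m * X + u * C) ≡ m * X + (u + M) * C
    id = solve-∀
  s2 : m * (M * X) ≤ m * (m * q)
  s2 = cancel-≤ (+-mono-≤ (cs M) (*-monoʳ-≤ M s1)) (≤-reflexive (id m M X q C))
    where
    id : ∀ m M X q C → m * (M * X) + (m * m * q + M * M * C + M * (m * X)) ≡ m * (m * q) + (2 * (m * M * X) + M * (M * C))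
    id = solve-∀
  s3 : M * X ≤ m * q
  s3 = *-cancelˡ-≤ m s2
  s4 : suc (suc k) * (M * X) ≤ m * (m * X + suc k * Y)
  s4 = ≤-trans (*-monoʳ-≤ (suc (suc k)) s3) (≤-trans (≤-reflexive (id (suc (suc k)) m q)) (*-monoʳ-≤ m hq))
    where
    id : ∀ a m q → a * (m * q) ≡ m * (a * q)
    id = solve-∀
  id₃ : ∀ k m X Y → suc k * (m * m * X) + m * (m * X + suc k * Y) ≡ suc k * (m * Y) + suc (suc k) * (m * m * X)
  id₃ = solve-∀
  id₄ : suc k * (m * Y) + suc (suc k) * (m * m * X) ≡ suc k * (m * Y + suc (suc k) * D * X) + suc (suc k) * (M * X)
  id₄ = trans (cong (λ t → suc k * (m * Y) + suc (suc k) * (t * X)) (sym eM)) (id k D M m X Y)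
    where
    id : ∀ k D M m X Y → suc k * (m * Y) + suc (suc k) * ((suc k * D + M) * X) ≡ suc k * (m * Y + suc (suc k) * D * X) + suc (suc k) * (M * X)
    id = solve-∀

∧-left : ∀ a b → a ∧ b ≡ true → a ≡ true
∧-left true b e = refl

∧-right : ∀ a b → a ∧ b ≡ true → b ≡ true
∧-right true b e = e

-- Clique densities from the number of nonadjacent pairs.

module Density {n : ℕ} (G : Graph n) where
  open Cliques G

  nonadj : Fin n → Pred n
  nonadj x y = not (N x y)

  codeg : Pred n → Fin n → ℕ
  codeg P x = # (P ∩ nonadj x)

  D : Pred n → ℕ
  D P = sumOn P (codeg P)

  deg+codeg : ∀ P x → # (P ∩ N x) + codeg P x ≡ # P
  deg+codeg P x = trans (sym (sum-+ _ _)) (sum-cong λ y → split (P y) (N x y))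
    where
    split : ∀ a b → ⟦ a ∧ b ⟧ + ⟦ a ∧ not b ⟧ ≡ ⟦ a ⟧
    split true  true  = refl
    split true  false = refl
    split false b     = refl

  cl-two : ∀ P → cl 2 P ≡ sumOn P (λ x → # (P ∩ N x))
  cl-two P = sumOn-cong P λ x → cl-one (P ∩ N x)

  cl-two+D : ∀ P → cl 2 P + D P ≡ # P * # P
  cl-two+D P = trans (cong (_+ D P) (cl-two P)) (trans (sym (sumOn-+ P _ _))
    (trans (sumOn-cong P (deg+codeg P)) (sumOn-const P (# P))))

  codeg-mono : ∀ {P P′} → (∀ x → P x ≡ true → P′ x ≡ true) → ∀ x → codeg P x ≤ codeg P′ x
  codeg-mono {P} {P′} h x = sum-mono pt
    where
    pt : ∀ y → ⟦ P y ∧ nonadj x y ⟧ ≤ ⟦ P′ y ∧ nonadj x y ⟧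
    pt y with P y in eq
    ... | true rewrite h y eq = ≤-refl
    ... | false = z≤n

  -- Sum (m · ext - M)² ≥ 0 over ordered k-cliques. The free `M` gives Cauchy-Schwarz without
  -- division by a clique count.
  second-moment : ∀ k P M → 2 * (# P * M * cl (suc k) P) ≤ # P * # P * Q k P + M * M * cl k P
  second-moment k P M = begin
    2 * (m * M * cl (suc k) P)
      ≡⟨ trans (reassoc m M (cl (suc k) P)) (cong (2 * (m * M) *_) (cl-suc k P)) ⟩
    2 * (m * M) * tup k P (ext P)
      ≡⟨ sym (tup-* k P (2 * (m * M)) (ext P)) ⟩
    tup k P (λ K → 2 * (m * M) * ext P K)
      ≤⟨ tup-mono k P (λ K → ≤-trans (≤-reflexive (l m M (ext P K))) (≤-trans (two-products (m * ext P K) M) (≤-reflexive (r m M (ext P K))))) ⟩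
    tup k P (λ K → m * m * (ext P K * ext P K) + M * M * 1)
      ≡⟨ tup-+ k P _ _ ⟩
    tup k P (λ K → m * m * (ext P K * ext P K)) + tup k P (λ _ → M * M * 1)
      ≡⟨ cong₂ _+_ (tup-* k P (m * m) (λ K → ext P K * ext P K)) (tup-* k P (M * M) (λ _ → 1)) ⟩
    m * m * Q k P + M * M * cl k P ∎
    where
    open ≤-Reasoning
    m = # P
    reassoc : ∀ m M X → 2 * (m * M * X) ≡ 2 * (m * M) * X
    reassoc = solve-∀
    l : ∀ m M c → 2 * (m * M) * c ≡ 2 * (m * c * M)
    l = solve-∀
    r : ∀ m M c → m * c * (m * c) + M * M ≡ m * m * (c * c) + M * M * 1
    r = solve-∀

  -- Divided by |P|: an average (k + 1)-clique extends in at least |P| - (k + 1) D / |P| ways, as if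
  -- its vertices had average codegree and disjoint sets of non-neighbours. For k = 0 this is an
  -- identity; `density-step` climbs from there.
  density : ∀ k P → # P * # P * cl (suc k) P ≤ # P * cl (suc (suc k)) P + suc k * D P * cl (suc k) P
  density zero P = ≤-reflexive (begin
    # P * # P * cl 1 P                   ≡⟨ cong (λ t → # P * # P * t) (cl-one P) ⟩
    # P * # P * # P                      ≡⟨ cong (_* # P) (sym (cl-two+D P)) ⟩
    (cl 2 P + D P) * # P                 ≡⟨ rearrange (cl 2 P) (D P) (# P) ⟩
    # P * cl 2 P + 1 * D P * # P         ≡⟨ cong (λ t → # P * cl 2 P + 1 * D P * t) (sym (cl-one P)) ⟩
    # P * cl 2 P + 1 * D P * cl 1 P      ∎)
    where
    open ≡-Reasoning
    rearrange : ∀ a d m → (a + d) * m ≡ m * a + 1 * d * m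
    rearrange = solve-∀
  density (suc k) P = density-step k (# P) (D P) (cl (suc k) P) (cl (suc (suc k)) P) (cl (suc (suc (suc k))) P) (Q (suc k) P)
    (density k P) (moon-moser (suc k) P) (second-moment (suc k) P)

  module _ (r : ℕ) (P : Pred n) (m>0 : 0 < # P) (sparse : r * D P ≤ # P * # P) where

    -- `sparse` bounds the average codegree by |P| / r, so in `density` each of the k + 1 vertices
    -- costs at most |P| / r, which leaves the fraction j / r.
    clique-ratio : ∀ k j → suc k + j ≡ r → j * # P * cl (suc k) P ≤ r * cl (suc (suc k)) P
    clique-ratio k j e = *-cancelˡ-≤ m {{>-nonZero m>0}} (cancel-≤ (+-mono-≤ (*-monoʳ-≤ r (density k P)) (*-monoʳ-≤ (suc k) (*-monoˡ-≤ C sparse)))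
      (≤-reflexive (trans (cong (λ t → m * (j * m * C) + (t * (m * X + suc k * D P * C) + suc k * (m * m * C))) (sym e))
        (trans (id k j m C X (D P)) (cong (λ t → m * (t * X) + (t * (m * m * C) + suc k * (t * D P * C))) e)))))
      where
      m = # P
      C = cl (suc k) P
      X = cl (suc (suc k)) P
      id : ∀ k j m C X d → m * (j * m * C) + ((suc k + j) * (m * X + suc k * d * C) + suc k * (m * m * C))
         ≡ m * ((suc k + j) * X) + ((suc k + j) * (m * m * C) + suc k * ((suc k + j) * d * C))
      id = solve-∀

    clique-chain : ∀ j k → suc k + j ≡ r → j ! * # P ^ j * cl (suc k) P ≤ r ^ j * cl r P
    clique-chain zero    k e = ≤-reflexive (cong (λ t → 1 * cl t P) (trans (sym (+-identityʳ (suc k))) e))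
    clique-chain (suc j) k e = begin
      (suc j * j !) * (m * m ^ j) * cl (suc k) P   ≡⟨ l (suc j) (j !) m (m ^ j) (cl (suc k) P) ⟩
      j ! * m ^ j * (suc j * m * cl (suc k) P)     ≤⟨ *-monoʳ-≤ (j ! * m ^ j) (clique-ratio k (suc j) e) ⟩
      j ! * m ^ j * (r * cl (suc (suc k)) P)       ≡⟨ c (j ! * m ^ j) r _ ⟩
      r * (j ! * m ^ j * cl (suc (suc k)) P)       ≤⟨ *-monoʳ-≤ r (clique-chain j (suc k) (trans (sym (+-suc (suc k) j)) e)) ⟩
      r * (r ^ j * cl r P)                         ≡⟨ sym (*-assoc r (r ^ j) (cl r P)) ⟩
      r * r ^ j * cl r P                           ∎
      where
      open ≤-Reasoning
      m = # P
      l : ∀ s f m q c → (s * f) * (m * q) * c ≡ f * q * (s * m * c)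
      l = solve-∀
      c : ∀ a r x → a * (r * x) ≡ r * (a * x)
      c = solve-∀

  cl-through-edges : ∀ k P B → (∀ x y → N x y ≡ true → cl k (N x ∩ N y) ≤ B) → cl (suc (suc k)) P ≤ cl 2 P * B
  cl-through-edges k P B h = begin
    sumOn P (λ x → sumOn (P ∩ N x) (λ y → cl k ((P ∩ N x) ∩ N y)))
      ≤⟨ sumOn-mono P (λ x _ → sumOn-mono (P ∩ N x) (λ y e → ≤-trans (cl-mono k (λ z → drop (P z) (N x z) (N y z))) (h x y (∧-right (P y) (N x y) e)))) ⟩
    sumOn P (λ x → sumOn (P ∩ N x) (λ y → B))
      ≡⟨ sumOn-cong P (λ x → trans (sumOn-const (P ∩ N x) B) (cong (_* B) (sym (cl-one (P ∩ N x))))) ⟩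
    sumOn P (λ x → cl 1 (P ∩ N x) * B)
      ≡⟨ sumOn-*ʳ P B _ ⟩
    cl 2 P * B ∎
    where
    open ≤-Reasoning
    drop : ∀ a b c → (a ∧ b) ∧ c ≡ true → b ∧ c ≡ true
    drop true b c e = e

  -- The chain climbs from edges to r-cliques, and the surplus `E` pays for the last step to (r +
  -- 1)-cliques. Distributing those over edges, at most `B` on each, makes `cl 2 P` a factor of both
  -- sides, so it cancels.
  supersaturation : ∀ p r → r ≡ suc (suc p) → ∀ P B E → 0 < # P → E + r * D P ≡ # P * # P →
    (∀ x y → N x y ≡ true → cl (suc p) (N x ∩ N y) ≤ B) →
    E * (p ! * # P ^ p) ≤ r ^ p * (# P * B)
  supersaturation p r refl P B E m>0 eE edge = *-cancelʳ-≤ _ _ (cl 2 P) {{>-nonZero cl2>0}} (begin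
    E * (p ! * m ^ p) * cl 2 P        ≡⟨ *-assoc E _ _ ⟩
    E * (p ! * m ^ p * cl 2 P)        ≤⟨ *-monoʳ-≤ E (clique-chain r P m>0 sparse p 1 refl) ⟩
    E * (r ^ p * cl r P)              ≡⟨ c E (r ^ p) _ ⟩
    r ^ p * (E * cl r P)              ≤⟨ *-monoʳ-≤ (r ^ p) last-step ⟩
    r ^ p * (m * cl (suc r) P)        ≤⟨ *-monoʳ-≤ (r ^ p) (*-monoʳ-≤ m (cl-through-edges (suc p) P B edge)) ⟩
    r ^ p * (m * (cl 2 P * B))        ≡⟨ d (r ^ p) m (cl 2 P) B ⟩
    r ^ p * (m * B) * cl 2 P          ∎)
    where
    open ≤-Reasoning
    m = # P
    sparse : r * D P ≤ m * m
    sparse = ≤-trans (m≤n+m _ E) (≤-reflexive eE)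
    c : ∀ a r x → a * (r * x) ≡ r * (a * x)
    c = solve-∀
    d : ∀ a m q B → a * (m * (q * B)) ≡ a * (m * B) * q
    d = solve-∀
    last-step : E * cl r P ≤ m * cl (suc r) P
    last-step = cancel-≤ (density (suc p) P) (≤-reflexive (trans (id E (cl r P) m (cl (suc r) P) (r * D P)) (cong (λ t → m * cl (suc r) P + t * cl r P) eE)))
      where
      id : ∀ E C m X u → E * C + (m * X + u * C) ≡ m * X + (E + u) * C
      id = solve-∀
    -- Without edges `D P` would be |P|², against `sparse` because r ≥ 2.
    cl2>0 : 0 < cl 2 P
    cl2>0 with cl 2 P in eq
    ... | suc _ = z<s
    ... | zero  = ⊥-elim (<⇒≱ (*-mono-< m>0 m>0) (+-cancelˡ-≤ (m * m) _ _ (≤-trans le (≤-reflexive (sym (+-identityʳ (m * m)))))))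
      where
      le : m * m + m * m ≤ m * m
      le = ≤-trans (+-monoʳ-≤ (m * m) (m≤m+n (m * m) (p * (m * m)))) (subst (λ t → r * t ≤ m * m) (trans (cong (_+ D P) (sym eq)) (cl-two+D P)) sparse)

  -- Each vertex loses at most c candidates, and r c ≤ m + e, so j more steps from W leave at least L of them.
  greedy : ∀ r c m e L U → (∀ x → U x ≡ true → codeg U x ≤ c) → r * c ≤ m + e → 0 < r →
    ∀ j W → (∀ x → W x ≡ true → U x ≡ true) → j * (m + e) + r * L ≤ r * # W →
    j ! * m ^ j * L ≤ r ^ j * cl (suc j) W
  greedy r c m e L U hc rc r>0 zero    W W⊆U h = ≤-trans (≤-reflexive (*-identityˡ L))
    (≤-trans (*-cancelˡ-≤ r {{>-nonZero r>0}} h) (≤-reflexive (trans (sym (cl-one W)) (sym (*-identityˡ (cl 1 W))))))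
  greedy r c m e L U hc rc r>0 (suc j) W W⊆U h = begin
    (suc j * j !) * (m * m ^ j) * L               ≡⟨ l (suc j) (j !) m (m ^ j) L ⟩
    suc j * m * (j ! * m ^ j * L)                 ≤⟨ *-monoˡ-≤ (j ! * m ^ j * L) size ⟩
    r * # W * (j ! * m ^ j * L)                   ≡⟨ *-assoc r (# W) _ ⟩
    r * (# W * (j ! * m ^ j * L))                 ≡⟨ cong (r *_) (sym (sumOn-const W _)) ⟩
    r * sumOn W (λ _ → j ! * m ^ j * L)           ≤⟨ *-monoʳ-≤ r (sumOn-mono W (λ x Wx → greedy r c m e L U hc rc r>0 j (W ∩ N x) (λ y → sub x y) (link x Wx))) ⟩
    r * sumOn W (λ x → r ^ j * cl (suc j) (W ∩ N x)) ≡⟨ cong (r *_) (sumOn-* W (r ^ j) _) ⟩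
    r * (r ^ j * cl (suc (suc j)) W)              ≡⟨ sym (*-assoc r (r ^ j) _) ⟩
    r * r ^ j * cl (suc (suc j)) W                ∎
    where
    open ≤-Reasoning
    l : ∀ s f m q c → (s * f) * (m * q) * c ≡ s * m * (f * q * c)
    l = solve-∀
    size : suc j * m ≤ r * # W
    size = ≤-trans (*-monoʳ-≤ (suc j) (m≤m+n m e)) (≤-trans (m≤m+n _ (r * L)) h)
    sub : ∀ x y → (W ∩ N x) y ≡ true → U y ≡ true
    sub x y with W y in eq
    ... | true  = λ _ → W⊆U y eq
    ... | false = λ ()
    link : ∀ x → W x ≡ true → j * (m + e) + r * L ≤ r * # (W ∩ N x)
    link x Wx = cancel-≤ (+-mono-≤ h (≤-trans (*-monoʳ-≤ r (≤-trans (codeg-mono W⊆U x) (hc x (W⊆U x Wx)))) rc))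
      (≤-reflexive (trans (cong (λ t → j * (m + e) + r * L + (r * t + (m + e))) (sym (deg+codeg W x)))
        (id j (m + e) (r * L) r (# (W ∩ N x)) (codeg W x))))
      where
      id : ∀ j f g r a b → j * f + g + (r * (a + b) + f) ≡ r * a + (suc j * f + g + r * b)
      id = solve-∀

  -- A pair in a clique with many common neighbours.

  IsClique : Pred n → List (Fin n) → Set
  IsClique P []      = ⊤
  IsClique P (x ∷ K) = P x ≡ true × IsClique (P ∩ N x) K

  clique-exists : ∀ k P → 0 < cl k P → ∃[ K ] (length K ≡ k × IsClique P K)
  clique-exists zero    P h = [] , refl , tt
  clique-exists (suc k) P h with sum-pos _ h
  ... | x , pos with P x in eq
  ...   | true with clique-exists k (P ∩ N x) (subst (0 <_) (*-identityˡ _) pos)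
  ...     | K , len , isK = x ∷ K , cong suc len , eq , isK

  nbrs : List (Fin n) → Fin n → ℕ
  nbrs []      z = 0
  nbrs (x ∷ K) z = ⟦ N x z ⟧ + nbrs K z

  -- The binomial coefficient of `nbrs K z` over 2, kept as a sum over pairs so that it can be
  -- exchanged with common neighbourhoods.
  nbrPairs : List (Fin n) → Fin n → ℕ
  nbrPairs []      z = 0
  nbrPairs (x ∷ K) z = ⟦ N x z ⟧ * nbrs K z + nbrPairs K z

  nbrPairs-square : ∀ K z → 2 * nbrPairs K z + nbrs K z ≡ nbrs K z * nbrs K z
  nbrPairs-square []      z = refl
  nbrPairs-square (x ∷ K) z = trans (id ⟦ N x z ⟧ (nbrs K z) (nbrPairs K z))
    (trans (cong₂ (λ s t → 2 * ⟦ N x z ⟧ * nbrs K z + s + t) (idem (N x z)) (nbrPairs-square K z)) (id′ ⟦ N x z ⟧ (nbrs K z)))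
    where
    id : ∀ t a b → 2 * (t * a + b) + (t + a) ≡ 2 * t * a + t + (2 * b + a)
    id = solve-∀
    id′ : ∀ t a → 2 * t * a + t * t + a * a ≡ (t + a) * (t + a)
    id′ = solve-∀
    idem : ∀ b → ⟦ b ⟧ ≡ ⟦ b ⟧ * ⟦ b ⟧
    idem true  = refl
    idem false = refl

  -- Each member of the clique misses at most `c` vertices of `P`. `R` shrinks along the clique
  -- while degrees are still taken in `P`.
  sumOn-nbrs : ∀ P c K → (∀ x → P x ≡ true → codeg P x ≤ c) → ∀ R → (∀ x → R x ≡ true → P x ≡ true) → IsClique R K →
    length K * # P ≤ sumOn P (nbrs K) + length K * c
  sumOn-nbrs P c []      hc R sub isK = z≤n
  sumOn-nbrs P c (x ∷ K) hc R sub (Rx , isK) = begin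
    # P + length K * # P
      ≤⟨ +-mono-≤ (≤-trans (≤-reflexive (sym (deg+codeg P x))) (+-monoʳ-≤ (# (P ∩ N x)) (hc x (sub x Rx))))
           (sumOn-nbrs P c K hc (R ∩ N x) (λ y e → sub y (∧-left (R y) (N x y) e)) isK) ⟩
    (# (P ∩ N x) + c) + (sumOn P (nbrs K) + length K * c)
      ≡⟨ id (# (P ∩ N x)) c (sumOn P (nbrs K)) (length K * c) ⟩
    (# (P ∩ N x) + sumOn P (nbrs K)) + (c + length K * c)
      ≡⟨ cong (_+ (c + length K * c)) (trans (cong (_+ sumOn P (nbrs K)) (sum-cong λ y → ⟦∧⟧ (P y) (N x y))) (sym (sumOn-+ P _ _))) ⟩
    sumOn P (nbrs (x ∷ K)) + (c + length K * c) ∎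
    where
    open ≤-Reasoning
    id : ∀ a b c d → (a + b) + (c + d) ≡ (a + c) + (b + d)
    id = solve-∀

  sumOn-nbrs-star : ∀ P r B x K R → (∀ y → R y ≡ true → suc (r * # ((P ∩ N x) ∩ N y)) ≤ B) → IsClique R K →
    r * sumOn P (λ z → ⟦ N x z ⟧ * nbrs K z) + length K ≤ length K * B
  sumOn-nbrs-star P r B x []      R h isK = ≤-reflexive (trans (+-identityʳ _) (trans (cong (r *_)
    (trans (sumOn-cong P λ z → *-zeroʳ ⟦ N x z ⟧) (trans (sumOn-const P 0) (*-zeroʳ (# P))))) (*-zeroʳ r)))
  sumOn-nbrs-star P r B x (y ∷ K) R h (Ry , isK) = begin
    r * sumOn P (λ z → ⟦ N x z ⟧ * (⟦ N y z ⟧ + nbrs K z)) + suc (length K)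
      ≡⟨ cong (λ t → r * t + suc (length K)) (trans (sumOn-cong P λ z → *-distribˡ-+ ⟦ N x z ⟧ ⟦ N y z ⟧ (nbrs K z)) (sumOn-+ P _ _)) ⟩
    r * (sumOn P (λ z → ⟦ N x z ⟧ * ⟦ N y z ⟧) + S) + suc (length K)
      ≡⟨ cong (λ t → r * (t + S) + suc (length K)) (sum-cong λ z → trans (sym (*-assoc ⟦ P z ⟧ ⟦ N x z ⟧ ⟦ N y z ⟧)) (trans (cong (_* ⟦ N y z ⟧) (sym (⟦∧⟧ (P z) (N x z)))) (sym (⟦∧⟧ (P z ∧ N x z) (N y z))))) ⟩
    r * (# ((P ∩ N x) ∩ N y) + S) + suc (length K)
      ≡⟨ id r (# ((P ∩ N x) ∩ N y)) S (length K) ⟩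
    suc (r * # ((P ∩ N x) ∩ N y)) + (r * S + length K)
      ≤⟨ +-mono-≤ (h y Ry) (sumOn-nbrs-star P r B x K (R ∩ N y) (λ z e → h z (∧-left (R z) (N y z) e)) isK) ⟩
    B + length K * B ∎
    where
    open ≤-Reasoning
    S = sumOn P (λ z → ⟦ N x z ⟧ * nbrs K z)
    id : ∀ r a s l → r * (a + s) + suc l ≡ suc (r * a) + (r * s + l)
    id = solve-∀

  triangle : ℕ → ℕ
  triangle zero    = 0
  triangle (suc l) = l + triangle l

  triangle-double : ∀ l → 2 * triangle (suc l) ≡ l * suc l
  triangle-double zero    = refl
  triangle-double (suc l) = trans (*-distribˡ-+ 2 (suc l) (triangle (suc l))) (trans (cong (2 * suc l +_) (triangle-double l)) (id l))
    where
    id : ∀ l → 2 * suc l + l * suc l ≡ suc l * suc (suc l)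
    id = solve-∀

  -- Double counting of clique pairs and their common neighbours. The assumed bound is strict, and
  -- the summand `triangle (length K)` keeps one unit per pair; the contradiction in `dense-pair`
  -- consists of these units.
  sumOn-nbrPairs : ∀ P r B K R → (∀ x → R x ≡ true → P x ≡ true) →
    (∀ x y → P x ≡ true → P y ≡ true → N x y ≡ true → suc (r * # ((P ∩ N x) ∩ N y)) ≤ B) → IsClique R K →
    r * sumOn P (nbrPairs K) + triangle (length K) ≤ triangle (length K) * B
  sumOn-nbrPairs P r B []      R sub h isK = ≤-reflexive (trans (+-identityʳ _) (trans (cong (r *_)
    (trans (sumOn-const P 0) (*-zeroʳ (# P)))) (*-zeroʳ r)))
  sumOn-nbrPairs P r B (x ∷ K) R sub h (Rx , isK) = begin
    r * sumOn P (λ z → ⟦ N x z ⟧ * nbrs K z + nbrPairs K z) + (length K + triangle (length K))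
      ≡⟨ cong (λ t → r * t + (length K + triangle (length K))) (sumOn-+ P _ _) ⟩
    r * (S + T) + (length K + triangle (length K))
      ≡⟨ id r S T (length K) (triangle (length K)) ⟩
    (r * S + length K) + (r * T + triangle (length K))
      ≤⟨ +-mono-≤ (sumOn-nbrs-star P r B x K (R ∩ N x) (λ y e → h x y (sub x Rx) (sub y (∧-left (R y) (N x y) e)) (∧-right (R y) (N x y) e)) isK)
                  (sumOn-nbrPairs P r B K (R ∩ N x) (λ y e → sub y (∧-left (R y) (N x y) e)) h isK) ⟩
    length K * B + triangle (length K) * B
      ≡⟨ sym (*-distribʳ-+ B (length K) (triangle (length K))) ⟩
    (length K + triangle (length K)) * B ∎
    where
    open ≤-Reasoning
    S = sumOn P (λ z → ⟦ N x z ⟧ * nbrs K z)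
    T = sumOn P (nbrPairs K)
    id : ∀ r s t a b → r * (s + t) + (a + b) ≡ (r * s + a) + (r * t + b)
    id = solve-∀

  -- A vertex with a neighbours in an (r+1)-clique sees a(a-1)/2 of its pairs, and
  -- a(a-1) ≥ 2(r-1)a - r(r-1); summing over all vertices, some pair has many common neighbours.
  dense-pair : ∀ p r → r ≡ suc (suc p) → ∀ c e U → (∀ x → U x ≡ true → codeg U x ≤ c) → r * c ≤ # U + e →
    (suc p * suc r * suc (suc r)) * e ≤ 2 * # U → 0 < cl (suc r) U →
    ∃[ x ] ∃[ y ] (U x ≡ true × U y ≡ true × N x y ≡ true × p * # U + suc p * e ≤ r * # ((U ∩ N x) ∩ N y))
  dense-pair p r refl c e U hc rc small pos with any? (λ x → any? (λ y →
      (U x ≟ᵇ true) ×-dec (U y ≟ᵇ true) ×-dec (N x y ≟ᵇ true) ×-dec (p * # U + suc p * e ≤? r * # ((U ∩ N x) ∩ N y))))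
  ... | yes found = found
  ... | no none with clique-exists (suc r) U pos
  ...   | K , len , isK = ⊥-elim (1+n≢0 (n≤0⇒n≡0 (+-cancelʳ-≤ (r * suc r * # U * (2 * suc p)) _ _ absurd′)))
    where
    open ≤-Reasoning
    m = # U
    Z = p * m + suc p * e
    S₁ = sumOn U (nbrs K)
    S₂ = sumOn U (nbrPairs K)
    pairs-sparse : r * (2 * S₂) + r * suc r ≤ r * suc r * Z
    pairs-sparse = begin
      r * (2 * S₂) + r * suc r      ≡⟨ cong₂ _+_ (c₁ r S₂) (sym double) ⟩
      2 * (r * S₂) + 2 * tri        ≡⟨ sym (*-distribˡ-+ 2 (r * S₂) tri) ⟩
      2 * (r * S₂ + tri)            ≤⟨ *-monoʳ-≤ 2 (sumOn-nbrPairs U r Z K U (λ _ h → h) (λ x y Ux Uy xy → ≰⇒> λ le → none (x , y , Ux , Uy , xy , le)) isK) ⟩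
      2 * (tri * Z)                 ≡⟨ trans (sym (*-assoc 2 tri Z)) (cong (_* Z) double) ⟩
      r * suc r * Z                 ∎
      where
      tri = triangle (length K)
      double : 2 * tri ≡ r * suc r
      double = trans (cong (λ l → 2 * triangle l) len) (triangle-double r)
      c₁ : ∀ r s → r * (2 * s) ≡ 2 * (r * s)
      c₁ = solve-∀
    degrees : suc r * m ≤ S₁ + suc r * c
    degrees = subst (λ l → l * m ≤ S₁ + l * c) len (sumOn-nbrs U c K hc U (λ _ h → h) isK)
    -- A vertex sees on average about (r + 1)(1 - 1 / r) members of the clique. This lies between r
    -- - 1 and r, so the gap inequality is used at r - 1.
    moments : 2 * suc p * S₁ ≤ 2 * S₂ + m * (suc p * r)
    moments = begin
      2 * suc p * S₁
        ≡⟨ sym (sumOn-* U (2 * suc p) (nbrs K)) ⟩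
      sumOn U (λ z → 2 * suc p * nbrs K z)
        ≤⟨ sumOn-mono U (λ z _ → cancel-≤ (consecutive-gap (suc p) (nbrs K z)) (≤-reflexive (pt z))) ⟩
      sumOn U (λ z → 2 * nbrPairs K z + suc p * r)
        ≡⟨ trans (sumOn-+ U _ _) (cong₂ _+_ (sumOn-* U 2 _) (sumOn-const U (suc p * r))) ⟩
      2 * S₂ + m * (suc p * r) ∎
      where
      pt : ∀ z → 2 * suc p * nbrs K z + (nbrs K z * nbrs K z + suc p * (suc p + 1)) ≡ 2 * nbrPairs K z + suc p * r + (suc p + suc p + 1) * nbrs K z
      pt z = trans (cong (λ t → 2 * suc p * nbrs K z + (t + suc p * (suc p + 1))) (sym (nbrPairs-square K z))) (id p (nbrs K z) (nbrPairs K z))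
        where
        id : ∀ p a b → 2 * suc p * a + (2 * b + a + suc p * (suc p + 1)) ≡ 2 * b + suc p * suc (suc p) + (suc p + suc p + 1) * a
        id = solve-∀
    combined : r * suc r * m * (2 * suc p) + r * suc r ≤ r * suc r * Z + r * m * (suc p * r) + suc r * (2 * suc p) * (m + e)
    combined = cancel-≤ (+-mono-≤ (+-mono-≤ pairs-sparse (*-monoʳ-≤ r moments))
        (+-mono-≤ (*-monoʳ-≤ (r * (2 * suc p)) degrees) (*-monoʳ-≤ (suc r * (2 * suc p)) rc)))
      (≤-reflexive (id r (suc p) m S₁ S₂ c e Z))
      where
      id : ∀ r q m a b c e Z →
        (r * suc r * m * (2 * q) + r * suc r) + ((r * suc r * Z + r * (2 * b + m * (q * r))) + (r * (2 * q) * (a + suc r * c) + suc r * (2 * q) * (m + e)))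
        ≡ (r * suc r * Z + r * m * (q * r) + suc r * (2 * q) * (m + e)) + (((r * (2 * b) + r * suc r) + r * (2 * q * a)) + (r * (2 * q) * (suc r * m) + suc r * (2 * q) * (r * c)))
      id = solve-∀
    -- `suc (p * 5 + 5 + p * p)` is r (r + 1), the units of strictness in `pairs-sparse`. The terms
    -- in `e` add up to (r - 1)(r + 1)(r + 2) e, exactly what `small` bounds.
    absurd′ : suc (p * 5 + 5 + p * p) + (r * suc r * m * (2 * suc p)) ≤ 0 + (r * suc r * m * (2 * suc p))
    absurd′ = cancel-≤ (+-mono-≤ combined small) (≤-reflexive (id p m e))
      where
      id : ∀ p m e →
        (suc (p * 5 + 5 + p * p) + suc (suc p) * suc (suc (suc p)) * m * (2 * suc p)) + ((suc (suc p) * suc (suc (suc p)) * (p * m + suc p * e) + suc (suc p) * m * (suc p * suc (suc p)) + suc (suc (suc p)) * (2 * suc p) * (m + e)) + 2 * m)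
        ≡ (0 + suc (suc p) * suc (suc (suc p)) * m * (2 * suc p)) + ((suc (suc p) * suc (suc (suc p)) * m * (2 * suc p) + suc (suc p) * suc (suc (suc p))) + (suc p * suc (suc (suc p)) * suc (suc (suc (suc p)))) * e)
      id = solve-∀

-- List counts of the definitions as finite sums, and sums over subsets.

⌊⌋-witness : ∀ {A : Set} (a? : Dec A) → ⌊ a? ⌋ ≡ true → A
⌊⌋-witness (yes a) _ = a

⌊⌋-true : ∀ {A : Set} (a? : Dec A) → A → ⌊ a? ⌋ ≡ true
⌊⌋-true (yes _) _ = refl
⌊⌋-true (no ¬a) a = ⊥-elim (¬a a)

countB : ∀ {A : Set} → (A → Bool) → List A → ℕ
countB f []       = 0
countB f (x ∷ xs) = ⟦ f x ⟧ + countB f xs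

length-filter : ∀ {A : Set} (f : A → Bool) (xs : List A) → length (filter (λ x → f x ≟ᵇ true) xs) ≡ countB f xs
length-filter f []       = refl
length-filter f (x ∷ xs) with f x
... | true  = cong suc (length-filter f xs)
... | false = length-filter f xs

countB-++ : ∀ {A : Set} (f : A → Bool) (xs ys : List A) → countB f (xs ++ˡ ys) ≡ countB f xs + countB f ys
countB-++ f []       ys = refl
countB-++ f (x ∷ xs) ys = trans (cong (⟦ f x ⟧ +_) (countB-++ f xs ys)) (sym (+-assoc ⟦ f x ⟧ _ _))

countB-map : ∀ {A B : Set} (f : B → Bool) (g : A → B) (xs : List A) → countB f (map g xs) ≡ countB (f ∘ g) xs
countB-map f g []       = refl
countB-map f g (x ∷ xs) = cong (⟦ f (g x) ⟧ +_) (countB-map f g xs)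

countB-filter : ∀ {A : Set} {P : A → Set} (P? : Decidable P) (f : A → Bool) (xs : List A) →
  countB f (filter P? xs) ≡ countB (λ x → ⌊ P? x ⌋ ∧ f x) xs
countB-filter P? f []       = refl
countB-filter P? f (x ∷ xs) with P? x
... | yes _ = cong (⟦ f x ⟧ +_) (countB-filter P? f xs)
... | no  _ = countB-filter P? f xs

countB-tabulate : ∀ {n} {A : Set} (f : A → Bool) (g : Fin n → A) → countB f (tabulate g) ≡ sum (λ i → ⟦ f (g i) ⟧)
countB-tabulate {zero}  f g = sym (sum-zero _)
countB-tabulate {suc n} f g = trans (cong (⟦ f (g zero) ⟧ +_) (countB-tabulate f (g ∘ suc))) (sym (sum-suc _))

countB-concatMap : ∀ {n} {A B : Set} (f : B → Bool) (h : A → List B) (g : Fin n → A) →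
  countB f (concatMap h (tabulate g)) ≡ sum (λ i → countB f (h (g i)))
countB-concatMap {zero}  f h g = sym (sum-zero _)
countB-concatMap {suc n} f h g = trans (countB-++ f (h (g zero)) _)
  (trans (cong (countB f (h (g zero)) +_) (countB-concatMap f h (g ∘ suc))) (sym (sum-suc _)))

sumS : ∀ {n} → (Subset n → ℕ) → ℕ
sumS {zero}  f = f []
sumS {suc n} f = sumS (λ S → f (true ∷ S)) + sumS (λ S → f (false ∷ S))

countB-allSubsets : ∀ n (f : Subset n → Bool) → countB f (allSubsets n) ≡ sumS (λ S → ⟦ f S ⟧)
countB-allSubsets zero    f = +-identityʳ _
countB-allSubsets (suc n) f = trans (countB-++ f (map (true ∷_) (allSubsets n)) _) (cong₂ _+_
  (trans (countB-map f (true ∷_) (allSubsets n)) (countB-allSubsets n (λ S → f (true ∷ S))))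
  (trans (countB-map f (false ∷_) (allSubsets n)) (countB-allSubsets n (λ S → f (false ∷ S)))))

sumS-mono : ∀ {n} {f g : Subset n → ℕ} → (∀ S → f S ≤ g S) → sumS f ≤ sumS g
sumS-mono {zero}  h = h []
sumS-mono {suc n} h = +-mono-≤ (sumS-mono (λ S → h (true ∷ S))) (sumS-mono (λ S → h (false ∷ S)))

term≤sumS : ∀ {n} (f : Subset n → ℕ) S → f S ≤ sumS f
term≤sumS f []          = ≤-refl
term≤sumS f (true  ∷ S) = ≤-trans (term≤sumS (λ S → f (true ∷ S)) S) (m≤m+n _ _)
term≤sumS f (false ∷ S) = ≤-trans (term≤sumS (λ S → f (false ∷ S)) S) (m≤n+m _ _)

sumS-* : ∀ {n} c (f : Subset n → ℕ) → sumS (λ S → c * f S) ≡ c * sumS f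
sumS-* {zero}  c f = refl
sumS-* {suc n} c f = trans (cong₂ _+_ (sumS-* c (λ S → f (true ∷ S))) (sumS-* c (λ S → f (false ∷ S)))) (sym (*-distribˡ-+ c _ _))

sum-sumS : ∀ {m n} (f : Fin m → Subset n → ℕ) → sum (λ i → sumS (f i)) ≡ sumS (λ S → sum (λ i → f i S))
sum-sumS {n = zero}  f = refl
sum-sumS {n = suc n} f = trans (sum-+ _ _) (cong₂ _+_ (sum-sumS (λ i S → f i (true ∷ S))) (sum-sumS (λ i S → f i (false ∷ S))))

⟦⟧-mono : ∀ {a b} → (a ≡ true → b ≡ true) → ⟦ a ⟧ ≤ ⟦ b ⟧
⟦⟧-mono {false} h = z≤n
⟦⟧-mono {true}  h rewrite h refl = ≤-refl

⟦⟧-zero : ∀ {a} → ¬ (a ≡ true) → ⟦ a ⟧ ≡ 0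
⟦⟧-zero {false} h = refl
⟦⟧-zero {true}  h = ⊥-elim (h refl)

-- Inserting `x` is injective on the subsets that miss `x`.
sumS-insert : ∀ {n} (x : Fin n) (f g : Subset n → Bool) →
  (∀ S → f S ≡ true → lookup S x ≡ false × g (S [ x ]≔ true) ≡ true) →
  sumS (λ S → ⟦ f S ⟧) ≤ sumS (λ S → ⟦ g S ⟧)
sumS-insert {suc n} zero f g h = begin
  sumS (λ S → ⟦ f (true ∷ S) ⟧) + sumS (λ S → ⟦ f (false ∷ S) ⟧)
    ≤⟨ +-mono-≤ (sumS-mono {g = λ _ → 0} (λ S → ≤-reflexive (⟦⟧-zero λ e → true≢false (proj₁ (h (true ∷ S) e)))))
                (sumS-mono (λ S → ⟦⟧-mono λ e → proj₂ (h (false ∷ S) e))) ⟩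
  sumS {n} (λ S → 0 * 0) + sumS (λ S → ⟦ g (true ∷ S) ⟧)
    ≡⟨ cong (_+ sumS (λ S → ⟦ g (true ∷ S) ⟧)) (sumS-* {n} 0 (λ _ → 0)) ⟩
  sumS (λ S → ⟦ g (true ∷ S) ⟧)
    ≤⟨ m≤m+n _ _ ⟩
  sumS (λ S → ⟦ g (true ∷ S) ⟧) + sumS (λ S → ⟦ g (false ∷ S) ⟧) ∎
  where
  open ≤-Reasoning
  true≢false : true ≡ false → ⊥
  true≢false ()
sumS-insert {suc n} (suc x) f g h = +-mono-≤
  (sumS-insert x (λ S → f (true ∷ S)) (λ S → g (true ∷ S)) (λ S → h (true ∷ S)))
  (sumS-insert x (λ S → f (false ∷ S)) (λ S → g (false ∷ S)) (λ S → h (false ∷ S)))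

sum-lookup : ∀ {n} (S : Subset n) → sum (λ x → ⟦ lookup S x ⟧) ≡ ∣ S ∣
sum-lookup []          = sum-zero _
sum-lookup (true  ∷ S) = trans (sum-suc _) (cong suc (sum-lookup S))
sum-lookup (false ∷ S) = trans (sum-suc _) (sum-lookup S)

∣insert∣ : ∀ {n} (S : Subset n) x → lookup S x ≡ false → ∣ S [ x ]≔ true ∣ ≡ suc ∣ S ∣
∣insert∣ (false ∷ S) zero    e = refl
∣insert∣ (true  ∷ S) (suc x) e = cong suc (∣insert∣ S x e)
∣insert∣ (false ∷ S) (suc x) e = ∣insert∣ S x e

∈-pairs⁻ : ∀ {n} {i j : Fin n} → (i , j) ∈ pairs n → toℕ i < toℕ j
∈-pairs⁻ {n} {i} {j} mem with ∈-concatMap⁻ (λ i → map (λ j → (i , j)) (filter (λ j → toℕ i <? toℕ j) (allFin n))) {xs = allFin n} mem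
... | a = go a
  where
  go : ∀ {xs} → Any (λ k → (i , j) ∈ map (λ j → (k , j)) (filter (λ j → toℕ k <? toℕ j) (allFin n))) xs → toℕ i < toℕ j
  go (there a) = go a
  go (here {k} p) with ∈-map⁻ (λ j → (k , j)) p
  ... | _ , q , refl = proj₂ (∈-filter⁻ (λ j → toℕ k <? toℕ j) {xs = allFin n} q)

∈-pairs⁺ : ∀ {n} {i j : Fin n} → toℕ i < toℕ j → (i , j) ∈ pairs n
∈-pairs⁺ {n} {i} {j} lt = ∈-concatMap⁺ (λ i → map (λ j → (i , j)) (filter (λ j → toℕ i <? toℕ j) (allFin n))) {xs = allFin n}
  (at (∈-allFin i))
  where
  at : ∀ {xs} → i ∈ xs → Any (λ k → (i , j) ∈ map (λ j → (k , j)) (filter (λ j → toℕ k <? toℕ j) (allFin n))) xs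
  at (here refl) = here (∈-map⁺ (λ j → (i , j)) (∈-filter⁺ (λ j → toℕ i <? toℕ j) (∈-allFin j) lt))
  at (there m)   = there (at m)

and-true : ∀ {A : Set} (f : A → Bool) (xs : List A) → (∀ x → x ∈ xs → f x ≡ true) → and (map f xs) ≡ true
and-true f []       h = refl
and-true f (x ∷ xs) h = trans (cong (_∧ and (map f xs)) (h x (here refl))) (and-true f xs λ y m → h y (there m))

foldr-⊔ : ∀ {A : Set} (f : A → ℕ) (xs : List A) {x} → x ∈ xs → f x ≤ foldr (λ y m → f y ⊔ m) 0 xs
foldr-⊔ f (y ∷ xs) (here refl) = m≤m⊔n (f y) _
foldr-⊔ f (y ∷ xs) (there m)   = ≤-trans (foldr-⊔ f xs m) (m≤n⊔m (f y) _)

-- From ordered cliques to clique subsets and `js`.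

module Subsets {n : ℕ} (G : Graph n) where
  open Cliques G

  Good : ℕ → Pred n → Subset n → Set
  Good k P S = ∣ S ∣ ≡ k × (∀ y → lookup S y ≡ true → P y ≡ true)
    × (∀ y z → lookup S y ≡ true → lookup S z ≡ true → ¬ (y ≡ z) → N y z ≡ true)

  good? : ∀ k P S → Dec (Good k P S)
  good? k P S = (∣ S ∣ ≟ k) ×-dec all? (λ y → (lookup S y ≟ᵇ true) →-dec (P y ≟ᵇ true))
    ×-dec all? (λ y → all? (λ z → (lookup S y ≟ᵇ true) →-dec ((lookup S z ≟ᵇ true) →-dec (¬? (y ≟ᶠ z) →-dec (N y z ≟ᵇ true)))))

  unordered : ℕ → Pred n → ℕ
  unordered k P = sumS (λ S → ⟦ ⌊ good? k P S ⌋ ⟧)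

  good-insert : ∀ k P x S → P x ≡ true → Good k (P ∩ N x) S → lookup S x ≡ false × Good (suc k) P (S [ x ]≔ true)
  good-insert k P x S Px (card , sub , clique) = fresh , trans (∣insert∣ S x fresh) (cong suc card) , sub′ , clique′
    where
    fresh : lookup S x ≡ false
    fresh with lookup S x in eq
    ... | false = refl
    ... | true with trans (sym (adj-irr G x)) (∧-right (P x) (N x x) (sub x eq))
    ...   | ()
    old : ∀ y → ¬ (y ≡ x) → lookup (S [ x ]≔ true) y ≡ true → lookup S y ≡ true
    old y y≢x h = trans (sym (lookup∘update′ y≢x S true)) h
    sub′ : ∀ y → lookup (S [ x ]≔ true) y ≡ true → P y ≡ true
    sub′ y h with y ≟ᶠ x
    ... | yes refl = Px
    ... | no y≢x   = ∧-left (P y) (N x y) (sub y (old y y≢x h))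
    clique′ : ∀ y z → lookup (S [ x ]≔ true) y ≡ true → lookup (S [ x ]≔ true) z ≡ true → ¬ (y ≡ z) → N y z ≡ true
    clique′ y z hy hz y≢z with y ≟ᶠ x | z ≟ᶠ x
    ... | yes refl | yes refl = ⊥-elim (y≢z refl)
    ... | yes refl | no z≢x   = ∧-right (P z) (N x z) (sub z (old z z≢x hz))
    ... | no y≢x   | yes refl = trans (adj-sym G y x) (∧-right (P y) (N x y) (sub y (old y y≢x hy)))
    ... | no y≢x   | no z≢x   = clique y z (old y y≢x hy) (old z z≢x hz) y≢z

  -- Choose the first vertex `x`, use induction in its link and insert `x`. A subset of size k + 1
  -- is reached from each of its members, hence the factor `suc k`.
  cl≤unordered : ∀ k P → cl k P ≤ k ! * unordered k P
  cl≤unordered zero P = ≤-trans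
    (≤-trans (≤-reflexive (cong ⟦_⟧ (sym (⌊⌋-true (good? 0 P ∅)
        (∣⊥∣≡0 n , (λ y e → ⊥-elim (absent y e)) , (λ y z e _ _ → ⊥-elim (absent y e)))))))
      (term≤sumS (λ S → ⟦ ⌊ good? 0 P S ⌋ ⟧) ∅))
    (≤-reflexive (sym (+-identityʳ _)))
    where
    absent : ∀ y → ¬ (lookup ∅ y ≡ true)
    absent y e with trans (sym (lookup-replicate y false)) e
    ... | ()
  cl≤unordered (suc k) P = begin
    sumOn P (λ x → cl k (P ∩ N x))
      ≤⟨ sumOn-mono P (λ x _ → cl≤unordered k (P ∩ N x)) ⟩
    sumOn P (λ x → k ! * unordered k (P ∩ N x))
      ≡⟨ sumOn-* P (k !) _ ⟩
    k ! * sumOn P (λ x → unordered k (P ∩ N x))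
      ≤⟨ *-monoʳ-≤ (k !) (sum-mono through) ⟩
    k ! * sum (λ x → sumS (λ S → ⟦ lookup S x ∧ ⌊ good? (suc k) P S ⌋ ⟧))
      ≡⟨ cong (k ! *_) (sum-sumS {n} {n} (λ x S → ⟦ lookup S x ∧ ⌊ good? (suc k) P S ⌋ ⟧)) ⟩
    k ! * sumS (λ S → sum (λ x → ⟦ lookup S x ∧ ⌊ good? (suc k) P S ⌋ ⟧))
      ≤⟨ *-monoʳ-≤ (k !) (sumS-mono size) ⟩
    k ! * sumS (λ S → suc k * ⟦ ⌊ good? (suc k) P S ⌋ ⟧)
      ≡⟨ cong (k ! *_) (sumS-* {n} (suc k) (λ S → ⟦ ⌊ good? (suc k) P S ⌋ ⟧)) ⟩
    k ! * (suc k * unordered (suc k) P)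
      ≡⟨ trans (sym (*-assoc (k !) (suc k) _)) (cong (_* unordered (suc k) P) (*-comm (k !) (suc k))) ⟩
    suc k ! * unordered (suc k) P ∎
    where
    open ≤-Reasoning
    through : ∀ x → ⟦ P x ⟧ * unordered k (P ∩ N x) ≤ sumS (λ S → ⟦ lookup S x ∧ ⌊ good? (suc k) P S ⌋ ⟧)
    through x with P x in eq
    ... | false = z≤n
    ... | true  = ≤-trans (≤-reflexive (+-identityʳ _)) (sumS-insert x _ _ λ S e →
      let fresh , good = good-insert k P x S eq (⌊⌋-witness (good? k (P ∩ N x) S) e)
      in fresh , cong₂ _∧_ (lookup∘update x S true) (⌊⌋-true (good? (suc k) P (S [ x ]≔ true)) good))
    size : ∀ S → sum (λ x → ⟦ lookup S x ∧ ⌊ good? (suc k) P S ⌋ ⟧) ≤ suc k * ⟦ ⌊ good? (suc k) P S ⌋ ⟧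
    size S = ≤-trans (≤-reflexive (trans (sum-cong λ x → ⟦∧⟧ (lookup S x) _)
      (trans (sym (sum-*ʳ _ (λ x → ⟦ lookup S x ⟧))) (cong (_* ⟦ ⌊ good? (suc k) P S ⌋ ⟧) (sum-lookup S))))) (bound (good? (suc k) P S))
      where
      bound : (d : Dec (Good (suc k) P S)) → ∣ S ∣ * ⟦ ⌊ d ⌋ ⟧ ≤ suc k * ⟦ ⌊ d ⌋ ⟧
      bound (yes g) = ≤-reflexive (cong (_* 1) (proj₁ g))
      bound (no _)  = ≤-reflexive (trans (*-zeroʳ ∣ S ∣) (sym (*-zeroʳ (suc k))))

  isCliqueB-true : ∀ S → (∀ y z → lookup S y ≡ true → lookup S z ≡ true → ¬ (y ≡ z) → N y z ≡ true) → isCliqueB G S ≡ true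
  isCliqueB-true S h = and-true _ (pairs n) λ where (i , j) m → pt i j (<⇒≢ (∈-pairs⁻ m))
    where
    pt : ∀ i j → toℕ i ≢ toℕ j → not (lookup S i ∧ lookup S j) ∨ N i j ≡ true
    pt i j i≢j with lookup S i in ei | lookup S j in ej
    ... | false | _     = refl
    ... | true  | false = refl
    ... | true  | true  = h i j ei ej (i≢j ∘ cong toℕ)

  -- Inserting `v` and then `u` turns a k-clique of the common neighbourhood into a clique on k + 2
  -- vertices through both; `g` describes the stage in between.
  cl≤cliquesThrough : ∀ k u v → N u v ≡ true → cl k (N u ∩ N v) ≤ k ! * cliquesThrough G (suc (suc k)) u v
  cl≤cliquesThrough k u v uv = ≤-trans (cl≤unordered k (N u ∩ N v)) (*-monoʳ-≤ (k !)
    (≤-trans (sumS-insert v _ g insert-v) (≤-trans (sumS-insert u g h insert-u)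
      (≤-reflexive (sym (trans (length-filter h (allSubsets n)) (countB-allSubsets n h)))))))
    where
    g h : Subset n → Bool
    g S = lookup S v ∧ ⌊ good? (suc k) (N u) S ⌋
    h S = ⌊ ∣ S ∣ ≟ suc (suc k) ⌋ ∧ lookup S u ∧ lookup S v ∧ isCliqueB G S
    insert-v : ∀ S → ⌊ good? k (N u ∩ N v) S ⌋ ≡ true → lookup S v ≡ false × g (S [ v ]≔ true) ≡ true
    insert-v S e = let fresh , good = good-insert k (N u) v S uv (⌊⌋-witness (good? k (N u ∩ N v) S) e)
      in fresh , cong₂ _∧_ (lookup∘update v S true) (⌊⌋-true (good? (suc k) (N u) (S [ v ]≔ true)) good)
    insert-u : ∀ S → g S ≡ true → lookup S u ≡ false × h (S [ u ]≔ true) ≡ true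
    insert-u S e with good-insert (suc k) (λ _ → true) u S refl (⌊⌋-witness (good? (suc k) (N u) S) (∧-right (lookup S v) _ e))
    ... | fresh , card , _ , clique = fresh , cong₂ _∧_ (⌊⌋-true (∣ S [ u ]≔ true ∣ ≟ suc (suc k)) card)
        (cong₂ _∧_ (lookup∘update u S true) (cong₂ _∧_ has-v (isCliqueB-true (S [ u ]≔ true) clique)))
      where
      has-v : lookup (S [ u ]≔ true) v ≡ true
      has-v with v ≟ᶠ u
      ... | yes refl = lookup∘update u S true
      ... | no v≢u   = trans (lookup∘update′ v≢u S true) (∧-left (lookup S v) _ e)

  -- `edges` lists each edge with its smaller end first, so the order of `u` and `v` decides which
  -- listed pair is used.
  cl≤js : ∀ k u v → N u v ≡ true → cl k (N u ∩ N v) ≤ k ! * js (suc k) G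
  cl≤js k u v uv with <-cmp (toℕ u) (toℕ v)
  ... | tri< u<v _ _ = ≤-trans (cl≤cliquesThrough k u v uv) (*-monoʳ-≤ (k !)
    (foldr-⊔ _ (edges G) (∈-filter⁺ (λ p → adj G (proj₁ p) (proj₂ p) ≟ᵇ true) (∈-pairs⁺ u<v) uv)))
  ... | tri> _ _ v<u = ≤-trans (≤-reflexive (cl-cong k λ y → ∧-comm (N u y) (N v y)))
    (≤-trans (cl≤cliquesThrough k v u vu) (*-monoʳ-≤ (k !)
    (foldr-⊔ _ (edges G) (∈-filter⁺ (λ p → adj G (proj₁ p) (proj₂ p) ≟ᵇ true) (∈-pairs⁺ v<u) vu))))
    where vu = trans (adj-sym G v u) uv
  ... | tri≈ _ u≡v _ with toℕ-injective u≡v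
  ...   | refl with trans (sym (adj-irr G u)) uv
  ...     | ()

  double-edges : e G + e G ≡ sum (λ i → sum (λ j → ⟦ N i j ⟧))
  double-edges = trans (cong₂ _+_ e-sum (trans e-sum (trans (sum-swap _) (sum-cong λ i → sum-cong λ j →
      cong (λ b → ⟦ ⌊ toℕ j <? toℕ i ⌋ ∧ b ⟧) (adj-sym G j i)))))
    (trans (sym (sum-+ _ _)) (sum-cong λ i → trans (sym (sum-+ _ _)) (sum-cong λ j → split i j)))
    where
    e-sum : e G ≡ sum (λ i → sum (λ j → ⟦ ⌊ toℕ i <? toℕ j ⌋ ∧ N i j ⟧))
    e-sum = trans (length-filter _ (pairs n)) (trans (countB-concatMap _ _ (λ i → i)) (sum-cong λ i →
      trans (countB-map _ (λ j → (i , j)) (filter (λ j → toℕ i <? toℕ j) (allFin n)))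
      (trans (countB-filter (λ j → toℕ i <? toℕ j) _ (allFin n)) (countB-tabulate _ (λ j → j)))))
    split : ∀ i j → ⟦ ⌊ toℕ i <? toℕ j ⌋ ∧ N i j ⟧ + ⟦ ⌊ toℕ j <? toℕ i ⌋ ∧ N i j ⟧ ≡ ⟦ N i j ⟧
    split i j with toℕ i <? toℕ j | toℕ j <? toℕ i
    ... | yes p | yes q = ⊥-elim (<-asym p q)
    ... | yes p | no q  = +-identityʳ _
    ... | no p  | yes q = refl
    ... | no p  | no q with toℕ-injective (≤-antisym (≮⇒≥ q) (≮⇒≥ p))
    ...   | refl = cong ⟦_⟧ (sym (adj-irr G i))

-- Sums over initial segments, minimisers and colour classes.

sum-last : ∀ n (f : ℕ → ℕ) → sum {suc n} (f ∘ toℕ) ≡ sum {n} (f ∘ toℕ) + f n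
sum-last zero    f = trans (sum-suc _) (trans (cong (f 0 +_) (sum-zero _)) (trans (+-comm (f 0) 0) (cong (_+ f 0) (sym (sum-zero _)))))
sum-last (suc n) f = trans (sum-suc _) (trans (cong (f 0 +_) (sum-last n (f ∘ suc)))
  (trans (sym (+-assoc (f 0) _ _)) (cong (_+ f (suc n)) (sym (sum-suc _)))))

⌊≟⌋-refl : ∀ a → ⌊ a ≟ a ⌋ ≡ true
⌊≟⌋-refl a = ⌊⌋-true (a ≟ a) refl

⌊⌋-false : ∀ {A : Set} (a? : Dec A) → ¬ A → ⌊ a? ⌋ ≡ false
⌊⌋-false (yes a) ¬a = ⊥-elim (¬a a)
⌊⌋-false (no _)  ¬a = refl

⌊⌋-iff : ∀ {A B : Set} (a? : Dec A) (b? : Dec B) → (A → B) → (B → A) → ⌊ a? ⌋ ≡ ⌊ b? ⌋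
⌊⌋-iff (yes a) b? f g = sym (⌊⌋-true b? (f a))
⌊⌋-iff (no ¬a) b? f g = sym (⌊⌋-false b? (¬a ∘ g))

sum-select : ∀ r c (g : ℕ → ℕ) → c < r → sum {r} (λ a → ⟦ ⌊ c ≟ toℕ a ⌋ ⟧ * g (toℕ a)) ≡ g c
sum-select (suc r) c g c<r with c ≟ r
... | yes refl = trans (sum-last r (λ a → ⟦ ⌊ c ≟ a ⌋ ⟧ * g a)) (cong₂ _+_
        (trans (sum-cong λ a → cong (λ b → ⟦ b ⟧ * g (toℕ a)) (⌊⌋-false (c ≟ toℕ a) (<⇒≢ (toℕ<n a) ∘ sym))) (trans (sum-const r 0) (*-zeroʳ r)))
        (trans (cong (λ b → ⟦ b ⟧ * g c) (⌊≟⌋-refl c)) (+-identityʳ (g c))))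
... | no c≢r   = trans (sum-last r (λ a → ⟦ ⌊ c ≟ a ⌋ ⟧ * g a)) (trans (cong₂ _+_
        (sum-select r c g (≤∧≢⇒< (s≤s⁻¹ c<r) c≢r)) (cong (λ b → ⟦ b ⟧ * g r) (⌊⌋-false (c ≟ r) c≢r))) (+-identityʳ (g c)))

sum-≤-indicator : ∀ r a → a < r → sum {r} (λ b → ⟦ ⌊ toℕ b ≤? a ⌋ ⟧) ≡ suc a
sum-≤-indicator (suc r) a a<r with a ≟ r
... | yes refl = trans (sum-cong λ b → cong ⟦_⟧ (⌊⌋-true (toℕ b ≤? a) (s≤s⁻¹ (toℕ<n b)))) (trans (sum-const (suc a) 1) (*-identityʳ (suc a)))
... | no a≢r   = trans (sum-last r (λ b → ⟦ ⌊ b ≤? a ⌋ ⟧)) (trans (cong₂ _+_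
        (sum-≤-indicator r a a<r′) (cong ⟦_⟧ (⌊⌋-false (r ≤? a) (<⇒≱ a<r′)))) (+-identityʳ (suc a)))
  where a<r′ = ≤∧≢⇒< (s≤s⁻¹ a<r) a≢r

argmin : ∀ {n} (P : Pred n) (f : Fin n → ℕ) →
  (∀ x → P x ≡ false) ⊎ ∃[ v ] (P v ≡ true × ∀ x → P x ≡ true → f v ≤ f x)
argmin {zero}  P f = inj₁ λ ()
argmin {suc n} P f with argmin (P ∘ suc) (f ∘ suc) | P zero in eq
... | inj₁ none          | false = inj₁ λ { zero → eq ; (suc x) → none x }
... | inj₁ none          | true  = inj₂ (zero , eq , λ { zero _ → ≤-refl ; (suc x) h → ⊥-elim (true≢false (trans (sym h) (none x))) })
  where
  true≢false : ¬ (true ≡ false)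
  true≢false ()
... | inj₂ (v , Pv , mn) | false = inj₂ (suc v , Pv , λ { zero h → ⊥-elim (false≢true (trans (sym eq) h)) ; (suc x) h → mn x h })
  where
  false≢true : ¬ (false ≡ true)
  false≢true ()
... | inj₂ (v , Pv , mn) | true with ≤-total (f zero) (f (suc v))
...   | inj₁ le = inj₂ (zero , eq , λ { zero _ → ≤-refl ; (suc x) h → ≤-trans le (mn x h) })
...   | inj₂ le = inj₂ (suc v , Pv , λ { zero _ → le ; (suc x) h → mn x h })

colourClass : ∀ {n} → (Fin n → ℕ) → Pred n → ℕ → Pred n
colourClass χ P a = P ∩ (λ y → ⌊ a ≟ χ y ⌋)

module _ {n : ℕ} (r : ℕ) (P : Pred n) (χ : Fin n → ℕ) (χ<r : ∀ x → P x ≡ true → χ x < r) where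

  size : ℕ → ℕ
  size a = # (colourClass χ P a)

  sumOn-colours : (g : ℕ → ℕ) → sumOn P (g ∘ χ) ≡ sum {r} (λ a → size (toℕ a) * g (toℕ a))
  sumOn-colours g = begin
    sum (λ x → ⟦ P x ⟧ * g (χ x))
      ≡⟨ sum-cong expand ⟩
    sum (λ x → sum {r} (λ a → ⟦ P x ∧ ⌊ toℕ a ≟ χ x ⌋ ⟧ * g (toℕ a)))
      ≡⟨ sum-swap _ ⟩
    sum {r} (λ a → sum (λ x → ⟦ P x ∧ ⌊ toℕ a ≟ χ x ⌋ ⟧ * g (toℕ a)))
      ≡⟨ sum-cong (λ a → sym (sum-*ʳ (g (toℕ a)) _)) ⟩
    sum {r} (λ a → size (toℕ a) * g (toℕ a)) ∎
    where
    open ≡-Reasoning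
    expand : ∀ x → ⟦ P x ⟧ * g (χ x) ≡ sum {r} (λ a → ⟦ P x ∧ ⌊ toℕ a ≟ χ x ⌋ ⟧ * g (toℕ a))
    expand x with P x in eq
    ... | false = sym (trans (sum-const r 0) (*-zeroʳ r))
    ... | true  = trans (+-identityʳ (g (χ x))) (trans (sym (sum-select r (χ x) g (χ<r x eq)))
      (sum-cong λ a → cong (λ b → ⟦ b ⟧ * g (toℕ a)) (⌊⌋-iff (χ x ≟ toℕ a) (toℕ a ≟ χ x) sym sym)))

  sum-size : sum {r} (λ a → size (toℕ a)) ≡ # P
  sum-size = trans (sum-cong λ a → sym (*-identityʳ (size (toℕ a)))) (trans (sym (sumOn-colours (λ _ → 1))) (sym (#-sumOn P)))

  module _ (q : ℕ) where

    private
      lhs : sum {r} (λ a → (q + q + 1) * size (toℕ a)) ≡ (q + q + 1) * # P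
      lhs = trans (sym (sum-*ˡ (q + q + 1) _)) (cong ((q + q + 1) *_) sum-size)
      rhs : sum {r} (λ a → size (toℕ a) * size (toℕ a) + q * (q + 1)) ≡ sumOn P (size ∘ χ) + r * (q * (q + 1))
      rhs = trans (sum-+ _ _) (cong₂ _+_ (sym (sumOn-colours size)) (sum-const r (q * (q + 1))))

    -- Sum (s - q)(s - q - 1) ≥ 0 over the r class sizes s. For q = |P| / r, `τ-form` turns this
    -- into a lower bound τ(|P|) on the sum of squared class sizes.
    class-squares : (q + q + 1) * # P ≤ sumOn P (size ∘ χ) + r * (q * (q + 1))
    class-squares = subst₂ _≤_ lhs rhs (sum-mono λ a → consecutive-gap q (size (toℕ a)))

    class-squares-eq : sumOn P (size ∘ χ) + r * (q * (q + 1)) ≤ (q + q + 1) * # P → ∀ a → a < r → size a ≡ q ⊎ size a ≡ suc q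
    class-squares-eq h a a<r = subst (λ b → size b ≡ q ⊎ size b ≡ suc q) (toℕ-fromℕ< a<r)
      (consecutive-gap-eq q (size (toℕ (fromℕ< a<r))) (sym (sum-squeeze _ _ (λ a → consecutive-gap q (size (toℕ a)))
        (subst₂ _≤_ (sym rhs) (sym lhs) h) (fromℕ< a<r))))

-- Degree majorisation and its equality case.

module Turan {n : ℕ} (G : Graph n) where
  open Cliques G
  open Density G

  class : (Fin n → ℕ) → Pred n → Fin n → ℕ
  class χ P x = # (colourClass χ P (χ x))

  -- Erdős's degree majorisation. In the equality case colours come in order of decreasing class size.
  record Majorant (r : ℕ) (P : Pred n) : Set where
    field
      χ       : Fin n → ℕ
      bounded : ∀ x → P x ≡ true → χ x < r
      below   : ∀ x → P x ≡ true → class χ P x ≤ codeg P x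
      tight   : (∀ x → P x ≡ true → codeg P x ≤ class χ P x) →
        (∀ x y → P x ≡ true → P y ≡ true → nonadj x y ≡ ⌊ χ x ≟ χ y ⌋)
        × (∀ x y → P x ≡ true → P y ≡ true → χ x ≤ χ y → class χ P y ≤ class χ P x)

  private
    empty-majorant : ∀ r P → (∀ x → P x ≡ false) → Majorant r P
    empty-majorant r P none = record
      { χ = λ _ → 0
      ; bounded = λ x h → ⊥-elim (absent x h)
      ; below = λ x h → ⊥-elim (absent x h)
      ; tight = λ _ → (λ x y h → ⊥-elim (absent x h)) , (λ x y h → ⊥-elim (absent x h)) }
      where
      absent : ∀ x → ¬ (P x ≡ true)
      absent x h with trans (sym (none x)) h
      ... | ()

    ⟦⟧-injective : ∀ {a b} → ⟦ a ⟧ ≡ ⟦ b ⟧ → a ≡ b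
    ⟦⟧-injective {true}  {true}  _ = refl
    ⟦⟧-injective {false} {false} _ = refl

  -- `v` has the fewest non-neighbours in `P`. These, `v` among them, become one class of colour
  -- `r`, so no vertex of that class has fewer non-neighbours than the class has members. The
  -- neighbours of `v` keep their classes from the link.
  module Extend (r : ℕ) (P : Pred n) (v : Fin n) (Pv : P v ≡ true)
                (least : ∀ x → P x ≡ true → codeg P v ≤ codeg P x) (M : Majorant r (P ∩ N v)) where
    open Majorant M renaming (χ to χ′; bounded to bounded′; below to below′; tight to tight′)

    A : Pred n
    A = P ∩ N v

    χ : Fin n → ℕ
    χ x = if N v x then χ′ x else r

    in-χ : ∀ x → N v x ≡ true → χ x ≡ χ′ x
    in-χ x h rewrite h = refl

    out-χ : ∀ x → N v x ≡ false → χ x ≡ r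
    out-χ x h rewrite h = refl

    in-A : ∀ x → P x ≡ true → N v x ≡ true → A x ≡ true
    in-A x h k rewrite h = k

    bounded : ∀ x → P x ≡ true → χ x < suc r
    bounded x h with N v x in eq
    ... | true  = m<n⇒m<1+n (bounded′ x (in-A x h eq))
    ... | false = ≤-refl

    out-same : ∀ x → N v x ≡ false → ∀ y → P y ≡ true → ⌊ χ x ≟ χ y ⌋ ≡ nonadj v y
    out-same x hx y hy rewrite out-χ x hx with N v y in eq
    ... | true  = ⌊⌋-false (r ≟ χ′ y) (>⇒≢ (bounded′ y (in-A y hy eq)))
    ... | false = ⌊≟⌋-refl r

    class-out : ∀ x → N v x ≡ false → class χ P x ≡ codeg P v
    class-out x hx = #-cong pt
      where
      pt : ∀ y → P y ∧ ⌊ χ x ≟ χ y ⌋ ≡ P y ∧ nonadj v y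
      pt y with P y in eq
      ... | true  = out-same x hx y eq
      ... | false = refl

    class-in : ∀ x → P x ≡ true → N v x ≡ true → class χ P x ≡ class χ′ A x
    class-in x Px hx = #-cong pt
      where
      pt : ∀ y → P y ∧ ⌊ χ x ≟ χ y ⌋ ≡ (P y ∧ N v y) ∧ ⌊ χ′ x ≟ χ′ y ⌋
      pt y rewrite in-χ x hx with P y | N v y
      ... | false | _     = refl
      ... | true  | true  = refl
      ... | true  | false = ⌊⌋-false (χ′ x ≟ r) (<⇒≢ (bounded′ x (in-A x Px hx)))

    below : ∀ x → P x ≡ true → class χ P x ≤ codeg P x
    below x Px = go (N v x) refl
      where
      go : ∀ b → N v x ≡ b → class χ P x ≤ codeg P x
      go false hx = ≤-trans (≤-reflexive (class-out x hx)) (least x Px)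
      go true  hx = ≤-trans (≤-reflexive (class-in x Px hx)) (≤-trans (below′ x (in-A x Px hx)) (codeg-mono (λ y → ∧-left (P y) (N v y)) x))

    module _ (full : ∀ x → P x ≡ true → codeg P x ≤ class χ P x) where

      full′ : ∀ x → A x ≡ true → codeg A x ≤ class χ′ A x
      full′ x h = ≤-trans (codeg-mono (λ y → ∧-left (P y) (N v y)) x)
        (≤-trans (full x (∧-left (P x) (N v x) h)) (≤-reflexive (class-in x (∧-left (P x) (N v x) h) (∧-right (P x) (N v x) h))))

      -- By `full`, a neighbour `x` of `v` has no more non-neighbours in `P` than in `A`, so none
      -- lie outside `A`.
      joined-out : ∀ x y → P x ≡ true → P y ≡ true → N v x ≡ true → N v y ≡ false → nonadj x y ≡ false
      joined-out x y Px Py hx hy = trans (sym (trans (cong (λ b → b ∧ nonadj x y) Py) refl)) (trans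
        (sym (⟦⟧-injective (sum-squeeze (λ z → ⟦ (A ∩ nonadj x) z ⟧) (λ z → ⟦ (P ∩ nonadj x) z ⟧)
          (λ z → ⟦⟧-mono (λ h → cong₂ _∧_ (∧-left (P z) (N v z) (∧-left (A z) (nonadj x z) h)) (∧-right (A z) (nonadj x z) h)))
          (≤-trans (full x Px) (≤-trans (≤-reflexive (class-in x Px hx)) (below′ x (in-A x Px hx)))) y)))
        (trans (cong (λ b → (P y ∧ b) ∧ nonadj x y) hy) (cong (λ b → (b ∧ false) ∧ nonadj x y) Py)))

      nonadj-sym : ∀ x y → nonadj x y ≡ nonadj y x
      nonadj-sym x y = cong not (adj-sym G x y)

      -- By `joined-out` every non-neighbour of `x` in `P` is one of `v`; by `least` there are at
      -- least as many, so the two sets coincide.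
      independent : ∀ x y → P x ≡ true → P y ≡ true → N v x ≡ false → N v y ≡ false → nonadj x y ≡ true
      independent x y Px Py hx hy = trans (sym (cong (_∧ nonadj x y) Py)) (trans
        (⟦⟧-injective (sum-squeeze (λ z → ⟦ (P ∩ nonadj x) z ⟧) (λ z → ⟦ (P ∩ nonadj v) z ⟧) pt (least x Px) y))
        (cong₂ _∧_ Py (cong not hy)))
        where
        pt : ∀ z → ⟦ P z ∧ nonadj x z ⟧ ≤ ⟦ P z ∧ nonadj v z ⟧
        pt z with P z in ez | N v z in ev
        ... | false | _     = z≤n
        ... | true  | false = ⟦⟧≤1 (nonadj x z)
        ... | true  | true  = ≤-reflexive (cong ⟦_⟧ (trans (nonadj-sym x z) (joined-out z x ez Px ev hx)))

      same : ∀ x y → P x ≡ true → P y ≡ true → nonadj x y ≡ ⌊ χ x ≟ χ y ⌋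
      same x y Px Py = go (N v x) (N v y) refl refl
        where
        go : ∀ a b → N v x ≡ a → N v y ≡ b → nonadj x y ≡ ⌊ χ x ≟ χ y ⌋
        go true true ex ey = trans (proj₁ (tight′ full′) x y (in-A x Px ex) (in-A y Py ey))
          (cong₂ (λ s t → ⌊ s ≟ t ⌋) (sym (in-χ x ex)) (sym (in-χ y ey)))
        go true false ex ey = trans (joined-out x y Px Py ex ey) (sym (trans (cong₂ (λ s t → ⌊ s ≟ t ⌋) (in-χ x ex) (out-χ y ey))
          (⌊⌋-false (χ′ x ≟ r) (<⇒≢ (bounded′ x (in-A x Px ex))))))
        go false true ex ey = trans (nonadj-sym x y) (trans (joined-out y x Py Px ey ex) (sym (trans (out-same x ex y Py) (cong not ey))))
        go false false ex ey = trans (independent x y Px Py ex ey) (sym (trans (out-same x ex y Py) (cong not ey)))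

      -- The outermost class has the largest colour, and its size is the least codegree.
      sorted : ∀ x y → P x ≡ true → P y ≡ true → χ x ≤ χ y → class χ P y ≤ class χ P x
      sorted x y Px Py = go (N v x) (N v y) refl refl
        where
        go : ∀ a b → N v x ≡ a → N v y ≡ b → χ x ≤ χ y → class χ P y ≤ class χ P x
        go a false ex ey le = ≤-trans (≤-reflexive (class-out y ey)) (≤-trans (least x Px) (full x Px))
        go true true ex ey le = subst₂ _≤_ (sym (class-in y Py ey)) (sym (class-in x Px ex))
          (proj₂ (tight′ full′) x y (in-A x Px ex) (in-A y Py ey) (subst₂ _≤_ (in-χ x ex) (in-χ y ey) le))
        go false true ex ey le = ⊥-elim (<⇒≱ (bounded′ y (in-A y Py ey)) (subst₂ _≤_ (out-χ x ex) (in-χ y ey) le))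

    majorant : Majorant (suc r) P
    majorant = record { χ = χ ; bounded = bounded ; below = below ; tight = λ full → same full , sorted full }

  cl-zero-link : ∀ k P v → P v ≡ true → cl (suc k) P ≡ 0 → cl k (P ∩ N v) ≡ 0
  cl-zero-link k P v Pv h = n≤0⇒n≡0 (≤-trans (≤-reflexive (trans (sym (+-identityʳ _)) (cong (λ b → ⟦ b ⟧ * cl k (P ∩ N v)) (sym Pv))))
    (≤-trans (term≤sum (λ x → ⟦ P x ⟧ * cl k (P ∩ N x)) v) (≤-reflexive h)))

  majorise : ∀ r P → cl (suc r) P ≡ 0 → Majorant r P
  majorise r P h with argmin P (codeg P)
  ... | inj₁ none = empty-majorant r P none
  -- With no colours left, `cl 0` of the link is 1, so `P` cannot contain `v`.
  majorise zero P h | inj₂ (v , Pv , _) with cl-zero-link 0 P v Pv h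
  ... | ()
  majorise (suc r) P h | inj₂ (v , Pv , least) =
    Extend.majorant r P v Pv least (majorise r (P ∩ N v) (cl-zero-link (suc r) P v Pv h))

-- Residues and the nonadjacent pairs of the Turán graph.

module Residues (r : ℕ) .{{_ : NonZero r}} where

  divMod-unique : ∀ q s → s < r → (s + q * r) / r ≡ q × (s + q * r) % r ≡ s
  divMod-unique q s s<r = *-cancelʳ-≡ _ _ r (+-cancelˡ-≡ s _ _ (trans (cong (_+ (s + q * r) / r * r) (sym rem)) (sym (m≡m%n+[m/n]*n (s + q * r) r)))) , rem
    where
    rem : (s + q * r) % r ≡ s
    rem = trans ([m+kn]%n≡m%n s q r) (m<n⇒m%n≡m s<r)

  data SucDivMod (n : ℕ) : Set where
    stay : suc n / r ≡ n / r → suc n % r ≡ suc (n % r) → SucDivMod n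
    wrap : suc n / r ≡ suc (n / r) → suc n % r ≡ 0 → suc (n % r) ≡ r → suc n ≡ r * suc (n / r) → SucDivMod n

  suc-divMod : ∀ n → SucDivMod n
  suc-divMod n with suc (n % r) ≟ r
  ... | no ≢r = stay (trans (cong (_/ r) eq) (proj₁ uniq)) (trans (cong (_% r) eq) (proj₂ uniq))
    where
    eq : suc n ≡ suc (n % r) + n / r * r
    eq = cong suc (m≡m%n+[m/n]*n n r)
    uniq = divMod-unique (n / r) (suc (n % r)) (≤∧≢⇒< (m%n<n n r) ≢r)
  ... | yes ≡r = wrap (trans (cong (_/ r) eq) (proj₁ uniq)) (trans (cong (_% r) eq) (proj₂ uniq)) ≡r (trans eq (*-comm (suc (n / r)) r))
    where
    eq : suc n ≡ 0 + suc (n / r) * r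
    eq = trans (cong suc (m≡m%n+[m/n]*n n r)) (cong (_+ n / r * r) ≡r)
    uniq = divMod-unique (suc (n / r)) 0 (≤-trans (s≤s z≤n) (m%n<n n r))

  -- The number of ordered pairs in the same part of the Turán graph.
  τ : ℕ → ℕ
  τ zero    = 0
  τ (suc n) = τ n + (n / r + n / r + 1)

  -- With q = n / r all parts have size q or q + 1, so the inequality behind `class-squares` is an
  -- equality for them.
  τ-form : ∀ n → τ n + r * (n / r * (n / r + 1)) ≡ (n / r + n / r + 1) * n
  τ-form zero = trans (cong (λ q → r * (q * (q + 1))) (0/n≡0 r)) (trans (*-zeroʳ r) (sym (*-zeroʳ (0 / r + 0 / r + 1))))
  τ-form (suc n) with suc-divMod n
  ... | stay e _ rewrite e = trans (id (τ n) q (r * (q * (q + 1)))) (trans (cong (_+ (q + q + 1)) (τ-form n)) (id′ q n))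
    where
    q = n / r
    id : ∀ t q x → t + (q + q + 1) + x ≡ t + x + (q + q + 1)
    id = solve-∀
    id′ : ∀ q n → (q + q + 1) * n + (q + q + 1) ≡ (q + q + 1) * suc n
    id′ = solve-∀
  ... | wrap e _ _ m rewrite e = trans (id (τ n) q r) (trans (cong₂ (λ a b → a + (q + q + 1) + 2 * b) (τ-form n) (sym m)) (id′ q n))
    where
    q = n / r
    id : ∀ t q r → t + (q + q + 1) + r * (suc q * (suc q + 1)) ≡ t + r * (q * (q + 1)) + (q + q + 1) + 2 * (r * suc q)
    id = solve-∀
    id′ : ∀ q n → (q + q + 1) * n + (q + q + 1) + 2 * suc n ≡ (suc q + suc q + 1) * suc n
    id′ = solve-∀

  -- With s = n % r, r τ(n) = n² + s (r - s); then s ≤ r gives the bound.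
  r*τ≤ : ∀ n → r * τ n ≤ n * n + r * r
  r*τ≤ n = cancel-≤ (z≤n {s * s}) (≤-trans (≤-reflexive eq) (+-monoˡ-≤ 0 (+-monoʳ-≤ (n * n) (*-monoʳ-≤ r (<⇒≤ (m%n<n n r))))))
    where
    s = n % r
    q = n / r
    id : ∀ r t q s → r * t + s * s + r * (r * (q * (q + 1))) ≡ r * (t + r * (q * (q + 1))) + s * s
    id = solve-∀
    id′ : ∀ r q s → r * ((q + q + 1) * (s + q * r)) + s * s ≡ (s + q * r) * (s + q * r) + r * s + 0 + r * (r * (q * (q + 1)))
    id′ = solve-∀
    eq : r * τ n + s * s ≡ n * n + r * s + 0
    eq = +-cancelʳ-≡ (r * (r * (q * (q + 1)))) _ _ (trans (id r (τ n) q s) (trans (cong (λ x → r * x + s * s) (τ-form n))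
      (trans (cong (λ x → r * ((q + q + 1) * x) + s * s) n≡) (trans (id′ r q s) (cong (λ x → x * x + r * s + 0 + r * (r * (q * (q + 1)))) (sym n≡))))))
      where
      n≡ : n ≡ s + q * r
      n≡ = m≡m%n+[m/n]*n n r

  residue-count : ∀ a n → a < r → sum {n} (λ i → ⟦ ⌊ toℕ i % r ≟ a ⌋ ⟧) ≡ n / r + ⟦ ⌊ a <? n % r ⌋ ⟧
  residue-count a zero    a<r = trans (sum-zero _) (sym (cong₂ _+_ (0/n≡0 r)
    (cong ⟦_⟧ (trans (cong (λ x → ⌊ a <? x ⌋) (m<n⇒m%n≡m (≤-trans (s≤s z≤n) a<r))) (⌊⌋-false (a <? 0) λ ())))))
  residue-count a (suc n) a<r = trans (sum-last n (λ i → ⟦ ⌊ i % r ≟ a ⌋ ⟧)) (trans (cong (_+ ⟦ ⌊ n % r ≟ a ⌋ ⟧) (residue-count a n a<r)) (step (suc-divMod n)))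
    where
    q = n / r
    split : ∀ s → ⟦ ⌊ a <? s ⌋ ⟧ + ⟦ ⌊ s ≟ a ⌋ ⟧ ≡ ⟦ ⌊ a <? suc s ⌋ ⟧
    split s with <-cmp a s
    ... | tri< lt ne _ rewrite ⌊⌋-true (a <? s) lt | ⌊⌋-false (s ≟ a) (ne ∘ sym) | ⌊⌋-true (a <? suc s) (m<n⇒m<1+n lt) = refl
    ... | tri≈ nlt refl _ rewrite ⌊⌋-false (a <? a) nlt | ⌊⌋-true (a ≟ a) refl | ⌊⌋-true (a <? suc a) ≤-refl = refl
    ... | tri> nlt ne gt rewrite ⌊⌋-false (a <? s) nlt | ⌊⌋-false (s ≟ a) (ne ∘ sym) | ⌊⌋-false (a <? suc s) (<⇒≱ (s≤s gt)) = refl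
    step : SucDivMod n → q + ⟦ ⌊ a <? n % r ⌋ ⟧ + ⟦ ⌊ n % r ≟ a ⌋ ⟧ ≡ suc n / r + ⟦ ⌊ a <? suc n % r ⌋ ⟧
    step (stay e₁ e₂) = trans (+-assoc q _ _) (trans (cong (q +_) (split (n % r)))
      (cong₂ (λ x y → x + ⟦ ⌊ a <? y ⌋ ⟧) (sym e₁) (sym e₂)))
    step (wrap e₁ e₂ e₃ _) = trans (+-assoc q _ _) (trans (cong (q +_) (split (n % r)))
      (trans (cong (λ x → q + ⟦ ⌊ a <? x ⌋ ⟧) e₃) (trans (cong (λ b → q + ⟦ b ⟧) (⌊⌋-true (a <? r) a<r))
      (trans (+-comm q 1) (trans (sym (+-identityʳ (suc q))) (cong₂ _+_ (sym e₁) (cong ⟦_⟧ (sym (trans (cong (λ x → ⌊ a <? x ⌋) e₂) (⌊⌋-false (a <? 0) λ ()))))))))))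

  same-residue : ℕ → ℕ → ℕ
  same-residue i j = ⟦ ⌊ i % r ≟ j % r ⌋ ⟧

  -- Vertex n enters a part with n / r earlier members: two ordered pairs with each, and one with
  -- itself, as in the recursion of `τ`.
  same-residue-count : ∀ n → sum {n} (λ i → sum {n} (λ j → same-residue (toℕ i) (toℕ j))) ≡ τ n
  same-residue-count zero    = sum-zero _
  same-residue-count (suc n) = begin
    sum {suc n} (λ i → sum {suc n} (λ j → same-residue (toℕ i) (toℕ j)))
      ≡⟨ sum-last n (λ i → sum {suc n} (λ j → same-residue i (toℕ j))) ⟩
    sum {n} (λ i → sum {suc n} (λ j → same-residue (toℕ i) (toℕ j))) + sum {suc n} (λ j → same-residue n (toℕ j))
      ≡⟨ cong₂ _+_ (trans (sum-cong λ i → sum-last n (same-residue (toℕ i))) (sum-+ _ _)) (sum-last n (same-residue n)) ⟩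
    (sum {n} (λ i → sum {n} (λ j → same-residue (toℕ i) (toℕ j))) + sum {n} (λ i → same-residue (toℕ i) n))
      + (sum {n} (λ j → same-residue n (toℕ j)) + same-residue n n)
      ≡⟨ cong₂ _+_ (cong₂ _+_ (same-residue-count n) column)
           (cong₂ _+_ (trans (sum-cong λ j → cong ⟦_⟧ (⌊⌋-iff (n % r ≟ toℕ j % r) (toℕ j % r ≟ n % r) sym sym)) column)
                      (cong ⟦_⟧ (⌊≟⌋-refl (n % r)))) ⟩
    (τ n + n / r) + (n / r + 1)
      ≡⟨ trans (+-assoc (τ n) (n / r) _) (cong (τ n +_) (sym (+-assoc (n / r) (n / r) 1))) ⟩
    τ n + (n / r + n / r + 1) ∎
    where
    open ≡-Reasoning
    column : sum {n} (λ i → same-residue (toℕ i) n) ≡ n / r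
    column = trans (residue-count (n % r) n (m%n<n n r)) (trans (cong (λ b → n / r + ⟦ b ⟧) (⌊⌋-false (n % r <? n % r) (<-irrefl refl))) (+-identityʳ (n / r)))

all : ∀ {n} → Pred n
all _ = true

#-all : ∀ n → # (all {n}) ≡ n
#-all n = trans (sum-const n 1) (*-identityʳ n)

D-all : ∀ {n} (G : Graph n) → e G + e G + Density.D G all ≡ n * n
D-all {n} G = trans (cong (_+ D all) (trans double-edges (trans (sum-cong λ i → sym (+-identityʳ _)) (sym (cl-two all))))) (trans (cl-two+D all) (cong₂ _*_ (#-all n) (#-all n)))
  where
  open Density G
  open Subsets G

D-turán : ∀ r .{{nz : NonZero r}} n → Density.D (turán r {{nz}} n) all ≡ Residues.τ r {{nz}} n
D-turán r {{nz}} n = trans (sum-cong λ i → trans (+-identityʳ _) (sum-cong λ j → cong ⟦_⟧ (not-involutive _))) (Residues.same-residue-count r {{nz}} n)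

D≤τ : ∀ r .{{nz : NonZero r}} n (G : Graph n) → t r {{nz}} n ≤ e G → Density.D G all ≤ Residues.τ r {{nz}} n
D≤τ r {{nz}} n G h = ≤-trans (cancel-≤ (+-mono-≤ h h) (≤-reflexive (trans (+-comm (Density.D G all) _) (trans (trans (D-all G) (sym (D-all (turán r {{nz}} n)))) (+-comm _ (Density.D (turán r {{nz}} n) all)))))) (≤-reflexive (D-turán r {{nz}} n))

-- Isomorphism with the Turán graph.

-- A missed value could be punched out, giving an injection into a smaller `Fin`.
injective⇒inverse : ∀ {n} (f : Fin n → Fin n) → Injective _≡_ _≡_ f → ∀ y → ∃[ x ] f x ≡ y
injective⇒inverse {suc n} f inj y with any? (λ x → f x ≟ᶠ y)
... | yes found = found
... | no none   = ⊥-elim (<⇒≱ ≤-refl (injective⇒≤ {f = λ x → punchOut (avoid x)} λ {x} {x′} eq → inj (punchOut-injective (avoid x) (avoid x′) eq)))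
  where
  avoid : ∀ x → y ≢ f x
  avoid x e = none (x , sym e)

-- `x` goes to the number whose residue is its colour and whose quotient is its rank in its class.
-- These numbers stay below n because larger classes have smaller colours, just as larger parts of
-- `turán` have smaller residues.
module Iso {n : ℕ} (G : Graph n) (r : ℕ) {{nz : NonZero r}} (r≤n : r ≤ n) (χ : Fin n → ℕ)
  (χ<r : ∀ x → χ x < r) (adj-χ : ∀ x y → adj G x y ≡ not ⌊ χ x ≟ χ y ⌋)
  (balanced : ∀ a → a < r → size r all χ (λ x _ → χ<r x) a ≡ n / r ⊎ size r all χ (λ x _ → χ<r x) a ≡ suc (n / r))
  (sorted : ∀ x y → χ x ≤ χ y → size r all χ (λ x _ → χ<r x) (χ y) ≤ size r all χ (λ x _ → χ<r x) (χ x)) where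

  private
    sz : ℕ → ℕ
    sz = size r all χ (λ x _ → χ<r x)
    q = n / r

  rank : Fin n → ℕ
  rank x = # (λ y → ⌊ toℕ y <? toℕ x ⌋ ∧ ⌊ χ x ≟ χ y ⌋)

  #-strict : ∀ {P Q : Pred n} → (∀ y → P y ≡ true → Q y ≡ true) → ∀ x → P x ≡ false → Q x ≡ true → # P < # Q
  #-strict {P} {Q} P⊆Q x Px Qx = ≰⇒> λ le → absurd (trans (sym (cong ⟦_⟧ Px)) (trans (sum-squeeze (λ y → ⟦ P y ⟧) (λ y → ⟦ Q y ⟧) (λ y → ⟦⟧-mono (P⊆Q y)) le x) (cong ⟦_⟧ Qx)))
    where
    absurd : ¬ (0 ≡ 1)
    absurd ()

  rank<size : ∀ x → rank x < sz (χ x)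
  rank<size x = #-strict (λ y → ∧-right ⌊ toℕ y <? toℕ x ⌋ ⌊ χ x ≟ χ y ⌋) x
    (cong (_∧ ⌊ χ x ≟ χ x ⌋) (⌊⌋-false (toℕ x <? toℕ x) (<-irrefl refl))) (⌊≟⌋-refl (χ x))

  rank-mono : ∀ x y → χ x ≡ χ y → toℕ x < toℕ y → rank x < rank y
  rank-mono x y χ≡ x<y = #-strict sub x (cong (_∧ ⌊ χ x ≟ χ x ⌋) (⌊⌋-false (toℕ x <? toℕ x) (<-irrefl refl)))
    (cong₂ _∧_ (⌊⌋-true (toℕ x <? toℕ y) x<y) (⌊⌋-true (χ y ≟ χ x) (sym χ≡)))
    where
    sub : ∀ z → ⌊ toℕ z <? toℕ x ⌋ ∧ ⌊ χ x ≟ χ z ⌋ ≡ true → ⌊ toℕ z <? toℕ y ⌋ ∧ ⌊ χ y ≟ χ z ⌋ ≡ true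
    sub z h = cong₂ _∧_
      (⌊⌋-true (toℕ z <? toℕ y) (<-trans (⌊⌋-witness (toℕ z <? toℕ x) (∧-left _ _ h)) x<y))
      (⌊⌋-true (χ y ≟ χ z) (trans (sym χ≡) (⌊⌋-witness (χ x ≟ χ z) (∧-right ⌊ toℕ z <? toℕ x ⌋ _ h))))

  rank-injective : ∀ x y → χ x ≡ χ y → rank x ≡ rank y → x ≡ y
  rank-injective x y χ≡ e with <-cmp (toℕ x) (toℕ y)
  ... | tri< lt _ _ = ⊥-elim (<⇒≢ (rank-mono x y χ≡ lt) e)
  ... | tri≈ _ eq _ = toℕ-injective eq
  ... | tri> _ _ gt = ⊥-elim (<⇒≢ (rank-mono y x (sym χ≡) gt) (sym e))

  q>0 : 0 < q
  q>0 with n / r in eq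
  ... | suc _ = z<s
  ... | zero  = ⊥-elim (<⇒≱ (m%n<n n r) (≤-trans r≤n (≤-reflexive (trans (m≡m%n+[m/n]*n n r) (trans (cong (λ k → n % r + k * r) eq) (+-identityʳ _))))))

  sz≥q : ∀ a → a < r → q ≤ sz a
  sz≥q a a<r with balanced a a<r
  ... | inj₁ e = ≤-reflexive (sym e)
  ... | inj₂ e = ≤-trans (n≤1+n q) (≤-reflexive (sym e))

  -- All colours up to `χ x` then have q + 1 vertices, and the total n has room for only n % r such
  -- colours.
  big-colour : ∀ x → sz (χ x) ≡ suc q → suc (χ x) ≤ n % r
  big-colour x big = +-cancelʳ-≤ (q * r) _ _ (begin
    suc (χ x) + q * r
      ≡⟨ cong₂ _+_ (sym (sum-≤-indicator r (χ x) (χ<r x))) (trans (*-comm q r) (sym (sum-const r q))) ⟩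
    sum {r} (λ b → ⟦ ⌊ toℕ b ≤? χ x ⌋ ⟧) + sum {r} (λ _ → q)
      ≡⟨ sym (sum-+ _ _) ⟩
    sum {r} (λ b → ⟦ ⌊ toℕ b ≤? χ x ⌋ ⟧ + q)
      ≤⟨ sum-mono (λ b → pt (toℕ b) (toℕ<n b)) ⟩
    sum {r} (λ b → sz (toℕ b))
      ≡⟨ trans (sum-size r all χ (λ x _ → χ<r x)) (trans (#-all n) (m≡m%n+[m/n]*n n r)) ⟩
    n % r + q * r ∎)
    where
    open ≤-Reasoning
    pt : ∀ b → b < r → ⟦ ⌊ b ≤? χ x ⌋ ⟧ + q ≤ sz b
    pt b b<r with b ≤? χ x
    ... | no _   = sz≥q b b<r
    -- `sorted` compares vertices, so a vertex of colour `b` is needed; it exists because q > 0,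
    -- which comes from r ≤ n.
    ... | yes le with sum-pos _ (≤-trans q>0 (sz≥q b b<r))
    ...   | y , pos with b ≟ χ y
    ...     | yes refl = ≤-trans (≤-reflexive (sym big)) (sorted y x le)

  code : Fin n → ℕ
  code x = χ x + rank x * r

  code<n : ∀ x → code x < n
  code<n x = ≤-trans (bound (balanced (χ x) (χ<r x))) (≤-reflexive (sym (m≡m%n+[m/n]*n n r)))
    where
    bound : sz (χ x) ≡ q ⊎ sz (χ x) ≡ suc q → code x < n % r + q * r
    bound (inj₁ e) = ≤-trans (+-monoˡ-≤ (rank x * r) (χ<r x)) (≤-trans (*-monoˡ-≤ r (≤-trans (rank<size x) (≤-reflexive e))) (m≤n+m (q * r) (n % r)))
    bound (inj₂ e) = +-mono-≤ (big-colour x e) (*-monoˡ-≤ r (s≤s⁻¹ (≤-trans (rank<size x) (≤-reflexive e))))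

  f : Fin n → Fin n
  f x = fromℕ< (code<n x)

  code-mod : ∀ x → toℕ (f x) % r ≡ χ x
  code-mod x = trans (cong (_% r) (toℕ-fromℕ< (code<n x))) (proj₂ (Residues.divMod-unique r (rank x) (χ x) (χ<r x)))

  f-injective : Injective _≡_ _≡_ f
  f-injective {x} {y} eq = rank-injective x y χ≡ (*-cancelʳ-≡ _ _ r (+-cancelˡ-≡ (χ x) _ _ (trans codes (cong (_+ rank y * r) (sym χ≡)))))
    where
    codes : code x ≡ code y
    codes = trans (sym (toℕ-fromℕ< (code<n x))) (trans (cong toℕ eq) (toℕ-fromℕ< (code<n y)))
    χ≡ : χ x ≡ χ y
    χ≡ = trans (sym (code-mod x)) (trans (cong (λ z → toℕ z % r) eq) (code-mod y))

  iso : G ≅ turán r {{nz}} n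
  iso = mk↔ₛ′ g f (λ x → f-injective (fg (f x))) fg , λ i j → trans (adj-χ (g i) (g j))
      (cong₂ (λ a b → not ⌊ a ≟ b ⌋) (χ-g i) (χ-g j))
    where
    g : Fin n → Fin n
    g y = proj₁ (injective⇒inverse f f-injective y)
    fg : ∀ y → f (g y) ≡ y
    fg y = proj₂ (injective⇒inverse f f-injective y)
    χ-g : ∀ i → χ (g i) ≡ toℕ i % r
    χ-g i = trans (sym (code-mod (g i))) (cong (λ z → toℕ z % r) (fg i))

-- Deleting a vertex.

sum-point : ∀ {n} (v : Fin n) (g : Fin n → ℕ) → sum (λ y → ⟦ ⌊ y ≟ᶠ v ⌋ ⟧ * g y) ≡ g v
sum-point {suc n} zero    g = trans (sum-suc _) (trans (cong₂ _+_ (+-identityʳ (g zero)) (trans (sum-const n 0) (*-zeroʳ n))) (+-identityʳ (g zero)))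
sum-point {suc n} (suc v) g = trans (sum-suc _) (trans
  (sum-cong λ y → cong (λ b → ⟦ b ⟧ * g (suc y)) (⌊⌋-iff (suc y ≟ᶠ suc v) (y ≟ᶠ v) (λ { refl → refl }) (cong suc)))
  (sum-point v (g ∘ suc)))

delete : ∀ {n} → Fin n → Pred n → Pred n
delete v P = P ∩ (λ y → not ⌊ y ≟ᶠ v ⌋)

module _ {n : ℕ} (P : Pred n) (v : Fin n) (Pv : P v ≡ true) where

  sumOn-delete : ∀ g → sumOn P g ≡ sumOn (delete v P) g + g v
  sumOn-delete g = trans (sum-cong λ y → split y (y ≟ᶠ v)) (trans (sum-+ _ _) (cong (sumOn (delete v P) g +_) (sum-point v g)))
    where
    split : ∀ y (d : Dec (y ≡ v)) → ⟦ P y ⟧ * g y ≡ ⟦ P y ∧ not ⌊ d ⌋ ⟧ * g y + ⟦ ⌊ d ⌋ ⟧ * g y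
    split y (yes refl) rewrite Pv = refl
    split y (no _) = trans (cong (λ b → ⟦ b ⟧ * g y) (sym (∧-identityʳ (P y)))) (sym (+-identityʳ _))

  #-delete : # P ≡ suc (# (delete v P))
  #-delete = trans (#-sumOn P) (trans (sumOn-delete (λ _ → 1)) (trans (cong (_+ 1) (sym (#-sumOn (delete v P)))) (+-comm _ 1)))

  module _ (G : Graph n) where
    open Density G

    codeg-delete : ∀ x → codeg P x ≡ codeg (delete v P) x + ⟦ nonadj x v ⟧
    codeg-delete x = trans (sum-cong λ y → ⟦∧⟧ (P y) (nonadj x y)) (trans (sumOn-delete (λ y → ⟦ nonadj x y ⟧))
      (cong (_+ ⟦ nonadj x v ⟧) (sum-cong λ y → sym (⟦∧⟧ (delete v P y) (nonadj x y)))))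

    -- `v` is the first entry of `codeg P v` pairs and the second entry of as many; the pair of `v`
    -- with itself is counted twice, hence the 1.
    D-delete : D (delete v P) + (codeg P v + codeg P v) ≡ D P + 1
    D-delete = sym (begin
      D P + 1
        ≡⟨ cong (_+ 1) (sumOn-delete (codeg P)) ⟩
      sumOn P′ (codeg P) + codeg P v + 1
        ≡⟨ cong (λ s → s + codeg P v + 1) (trans (sumOn-cong P′ codeg-delete) (sumOn-+ P′ _ _)) ⟩
      D P′ + sumOn P′ (λ x → ⟦ nonadj x v ⟧) + codeg P v + 1
        ≡⟨ cong (λ s → D P′ + s + codeg P v + 1) (sum-cong λ x → trans (sym (⟦∧⟧ (P′ x) (nonadj x v))) (cong (λ b → ⟦ P′ x ∧ not b ⟧) (adj-sym G x v))) ⟩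
      D P′ + codeg P′ v + codeg P v + 1
        ≡⟨ rearrange (D P′) (codeg P′ v) (codeg P v) ⟩
      D P′ + (codeg P′ v + 1 + codeg P v)
        ≡⟨ cong (λ s → D P′ + (s + codeg P v)) (sym (trans (codeg-delete v) (cong (λ b → codeg P′ v + ⟦ not b ⟧) (adj-irr G v)))) ⟩
      D P′ + (codeg P v + codeg P v) ∎)
      where
      open ≡-Reasoning
      P′ = delete v P
      rearrange : ∀ d a b → d + a + b + 1 ≡ d + (a + 1 + b)
      rearrange = solve-∀

-- Numerical estimates.

-- With n = m + i this is (1 - i / n) ^ j ≥ 1 - j i / n, multiplied by n ^ (j + 1).
bernoulli : ∀ m i j → (m + i) * (m + i) ^ j ≤ (m + i) * m ^ j + j * i * (m + i) ^ j
bernoulli m i zero    = ≤-reflexive (sym (+-identityʳ _))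
bernoulli m i (suc j) = begin
  n * (n * n ^ j)
    ≤⟨ *-monoʳ-≤ n (bernoulli m i j) ⟩
  n * (n * m ^ j + j * i * n ^ j)
    ≡⟨ id m i (m ^ j) j (n ^ j) ⟩
  n * (m * m ^ j) + (i * (n * m ^ j) + j * i * (n * n ^ j))
    ≤⟨ +-monoʳ-≤ (n * (m * m ^ j)) (+-monoˡ-≤ (j * i * (n * n ^ j)) (*-monoʳ-≤ i (*-monoʳ-≤ n (^-monoˡ-≤ j (m≤m+n m i))))) ⟩
  n * (m * m ^ j) + (i * (n * n ^ j) + j * i * (n * n ^ j))
    ≡⟨ cong (n * (m * m ^ j) +_) (id′ i j (n * n ^ j)) ⟩
  n * (m * m ^ j) + suc j * i * (n * n ^ j) ∎
  where
  open ≤-Reasoning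
  n = m + i
  id : ∀ m i a j b → (m + i) * ((m + i) * a + j * i * b) ≡ (m + i) * (m * a) + (i * ((m + i) * a) + j * i * ((m + i) * b))
  id = solve-∀
  id′ : ∀ i j x → i * x + j * i * x ≡ suc j * i * x
  id′ = solve-∀

power-loss : ∀ n m i j → m + i ≡ n → 0 < n → 2 * (j * i) ≤ n → n ^ j ≤ 2 * m ^ j
power-loss n m i j refl n>0 h = *-cancelˡ-≤ n {{>-nonZero n>0}}
  (cancel-≤ (+-mono-≤ (*-monoʳ-≤ 2 (bernoulli m i j)) (*-monoˡ-≤ (n ^ j) h)) (≤-reflexive (id n (n ^ j) (m ^ j) (j * i))))
  where
  id : ∀ n a b u → n * a + (2 * (n * b + u * a) + n * a) ≡ n * (2 * b) + (2 * (n * a) + 2 * u * a)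
  id = solve-∀

-- Admits `power-loss` with exponent p after up to r² k deletions; it comes down to 2 p ≤ r².
double-loss : ∀ {p r} → r ≡ suc (suc p) → ∀ k → 2 * (p * (r * r * k)) ≤ r * r * (r * r) * k
double-loss {p} {r} refl k = cancel-≤ {x = 0} z≤n (≤-reflexive (id p k))
  where
  id : ∀ p k → 2 * (p * (suc (suc p) * suc (suc p) * k)) + suc (suc p) * suc (suc p) * (4 + 2 * p + p * p) * k
     ≡ suc (suc p) * suc (suc p) * (suc (suc p) * suc (suc p)) * k + 0
  id = solve-∀

-- The size condition of `dense-pair` for slack r k and at least r⁴ k - r² k vertices. The surplus p
-- (p + 1)(p + 2)(p + 3) k vanishes at r = 2.
slack-bound : ∀ {p r} → r ≡ suc (suc p) → ∀ k → suc p * suc r * suc (suc r) * (r * k) + 2 * (r * r * k) ≤ 2 * (r * r * (r * r) * k)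
slack-bound {p} {r} refl k = cancel-≤ {x = 0} z≤n (≤-reflexive (id p k))
  where
  id : ∀ p k → suc p * suc (suc (suc p)) * suc (suc (suc (suc p))) * (suc (suc p) * k) + 2 * (suc (suc p) * suc (suc p) * k) + (1 + p) * (2 + p) * (3 + p) * p * k
     ≡ 2 * (suc (suc p) * suc (suc p) * (suc (suc p) * suc (suc p)) * k) + 0
  id = solve-∀

-- By k + 1 ≤ 2 k it comes down to 4 (r - 1) ≤ r³.
greedy-margin : ∀ {p r} → r ≡ suc (suc p) → ∀ k → 1 ≤ k → 2 * suc p * (r * r * (r * r) * suc k) ≤ k * (r * r * r * (r * r * (r * r)))
greedy-margin {p} {r} refl k k>0 = cancel-≤ (*-monoʳ-≤ (2 * suc p * (r * r * (r * r))) k>0)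
    (cancel-≤ {x = 0} z≤n (≤-reflexive (id p k)))
  where
  id : ∀ p k → 2 * suc p * (suc (suc p) * suc (suc p) * (suc (suc p) * suc (suc p)) * suc k) + 2 * suc p * (suc (suc p) * suc (suc p) * (suc (suc p) * suc (suc p))) * k
       + (2 + p) * (2 + p) * ((2 + p) * (2 + p)) * k * (4 + 8 * p + 6 * p * p + p * p * p)
     ≡ k * (suc (suc p) * suc (suc p) * suc (suc p) * (suc (suc p) * suc (suc p) * (suc (suc p) * suc (suc p)))) + 2 * suc p * (suc (suc p) * suc (suc p) * (suc (suc p) * suc (suc p))) * 1 + 0
  id = solve-∀

-- Comes down to 4 (r - 1) + 1 ≤ 2 r². Here 2 k² stands for (k + 1)², and r k² absorbs the error r²
-- of `r*τ≤`.
excess-margin : ∀ {p r} → r ≡ suc (suc p) → ∀ k → 2 * suc p * (r * (2 * (k * k))) + r * (k * k) ≤ r * (2 * (r * r * k * k))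
excess-margin {p} {r} refl k = cancel-≤ {x = 0} z≤n (≤-reflexive (id p k))
  where
  id : ∀ p k → 2 * suc p * (suc (suc p) * (2 * (k * k))) + suc (suc p) * (k * k) + (2 + p) * (3 + 4 * p + 2 * p * p) * (k * k)
     ≡ suc (suc p) * (2 * (suc (suc p) * suc (suc p) * k * k)) + 0
  id = solve-∀

deletions-bound : ∀ {p r} → r ≡ suc (suc p) → ∀ k → 1 ≤ k → suc (r * r * k) ≤ r * r * (r * r) * k
deletions-bound {p} {r} refl k k>0 = cancel-≤ k>0 (cancel-≤ {x = 0} z≤n (≤-reflexive (id p k)))
  where
  id : ∀ p k → suc (suc (suc p) * suc (suc p) * k) + k + (11 + 28 * p + 23 * p * p + 8 * p * p * p + p * p * p * p) * k
     ≡ suc (suc p) * suc (suc p) * (suc (suc p) * suc (suc p)) * k + 1 + 0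
  id = solve-∀

-- k is n / r⁴ rounded down, and at most ℓ = r² k vertices are deleted.
module FinalEstimates (p r n k : ℕ) (r≡ : r ≡ suc (suc p)) (r>0 : 0 < r)
  (k-lower : r * r * (r * r) * k ≤ n) (k-upper : n < r * r * (r * r) * suc k) (r≤k : r ≤ k) (G : Graph n) where

  private
    r⁷ jt ℓ : ℕ
    r⁷ = r * r * r * (r * r * (r * r))
    jt = js r G
    ℓ  = r * r * k

  open Cliques G
  open Density G
  open Subsets G

  Goal : Set
  Goal = n * n ^ p < jt * (r ^ p * r⁷)

  k>0 : 0 < k
  k>0 = ≤-trans r>0 r≤k

  n>0 : 0 < n
  n>0 = ≤-trans (s≤s z≤n) (≤-trans (deletions-bound r≡ k k>0) k-lower)

  through-edge : ∀ x y → N x y ≡ true → cl (suc p) (N x ∩ N y) ≤ suc p ! * jt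
  through-edge x y xy = subst (λ s → cl (suc p) (N x ∩ N y) ≤ suc p ! * js s G) (sym r≡) (cl≤js (suc p) x y xy)

  -- Shared by both ways of winning, with `E` the surplus or n k. The 2 is the price of m in place
  -- of n; `suc p` is (r - 1)! / (r - 2)!, where (r - 1)! comes from forgetting the order of
  -- cliques.
  finish : ∀ E m → E * (p ! * m ^ p) ≤ r ^ p * (n * (suc p ! * jt)) → n ^ p ≤ 2 * m ^ p → 2 * suc p * (n * n) < E * r⁷ → Goal
  finish E m count loss big = ≰⇒> λ small → <⇒≱ big (*-cancelˡ-≤ (p ! * n ^ p) {{m*n≢0 (p !) (n ^ p) {{p !≢0}} {{m^n≢0 n p {{>-nonZero n>0}}}}}} (begin
    p ! * n ^ p * (E * r⁷)                                  ≤⟨ *-monoˡ-≤ (E * r⁷) (*-monoʳ-≤ (p !) loss) ⟩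
    p ! * (2 * m ^ p) * (E * r⁷)                            ≡⟨ id₁ (p !) (m ^ p) E r⁷ ⟩
    2 * r⁷ * (E * (p ! * m ^ p))                            ≤⟨ *-monoʳ-≤ (2 * r⁷) count ⟩
    2 * r⁷ * (r ^ p * (n * (suc p * p ! * jt)))              ≡⟨ id₂ r⁷ (r ^ p) n (suc p) (p !) jt ⟩
    2 * suc p * n * p ! * (jt * (r ^ p * r⁷))                ≤⟨ *-monoʳ-≤ (2 * suc p * n * p !) small ⟩
    2 * suc p * n * p ! * (n * n ^ p)                       ≡⟨ id₃ (suc p) n (p !) (n ^ p) ⟩
    p ! * n ^ p * (2 * suc p * (n * n))                     ∎))
    where
    open ≤-Reasoning
    id₁ : ∀ f a E s → f * (2 * a) * (E * s) ≡ 2 * s * (E * (f * a))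
    id₁ = solve-∀
    id₂ : ∀ s a n q f jt → 2 * s * (a * (n * (q * f * jt))) ≡ 2 * q * n * f * (jt * (a * s))
    id₂ = solve-∀
    id₃ : ∀ q n f a → 2 * q * n * f * (n * a) ≡ f * a * (2 * q * (n * n))
    id₃ = solve-∀

  loss-bound : ∀ m i → m + i ≡ n → i ≤ ℓ → n ^ p ≤ 2 * m ^ p
  loss-bound m i e i≤ℓ = power-loss n m i p e n>0 (≤-trans (*-monoʳ-≤ 2 (*-monoʳ-≤ p i≤ℓ))
    (≤-trans (double-loss r≡ k) k-lower))

  pair-case : ∀ m i P c → # P ≡ m → m + i ≡ n → i ≤ ℓ → (∀ x → P x ≡ true → codeg P x ≤ c) → r * c ≤ m + r * k →
    0 < cl (suc r) P → Goal
  pair-case m i P c refl e i≤ℓ hc rc pos with dense-pair p r r≡ c (r * k) P hc rc small pos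
    where
    small : suc p * suc r * suc (suc r) * (r * k) ≤ 2 * # P
    small = cancel-≤ (+-mono-≤ (slack-bound r≡ k) (+-mono-≤ (*-monoʳ-≤ 2 k-lower) (*-monoʳ-≤ 2 i≤ℓ)))
      (≤-reflexive (trans (cong (λ t → X + (2 * (r * r * (r * r) * k) + (2 * t + 2 * ℓ))) (sym e)) (id X (r * r * (r * r) * k) (# P) i ℓ)))
      where
      X = suc p * suc r * suc (suc r) * (r * k)
      id : ∀ x a m i l → x + (2 * a + (2 * (m + i) + 2 * l)) ≡ 2 * m + (x + 2 * l + (2 * a + 2 * i))
      id = solve-∀
  ... | x , y , Px , Py , xy , dense = finish (n * k) m
    (≤-trans (≤-reflexive (id₁ n k (p !) (m ^ p))) (≤-trans (*-monoʳ-≤ n counted) (≤-reflexive (id₂ n (r ^ p) (suc p ! * jt)))))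
    (loss-bound m i e i≤ℓ)
    (≤-trans (≤-reflexive (cong suc (id₃ (2 * suc p) n))) (≤-trans (*-monoʳ-< n {{>-nonZero n>0}} big) (≤-reflexive (sym (*-assoc n k r⁷)))))
    where
    W = (P ∩ N x) ∩ N y
    counted : p ! * m ^ p * k ≤ r ^ p * (suc p ! * jt)
    -- The bound from `dense-pair` pays for exactly p steps of cost m + r k with k candidates left
    -- at the end: `e` is r k and `L` is k.
    counted = ≤-trans (greedy r c m (r * k) k P hc rc r>0 p W
        (λ z h → ∧-left (P z) (N x z) (∧-left (P z ∧ N x z) (N y z) h))
        (≤-trans (≤-reflexive (id p m (r * k))) dense))
      (*-monoʳ-≤ (r ^ p) (≤-trans (cl-mono (suc p) (λ z h → cong₂ _∧_ (∧-right (P z) (N x z) (∧-left (P z ∧ N x z) (N y z) h)) (∧-right (P z ∧ N x z) (N y z) h)))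
        (through-edge x y xy)))
      where
      id : ∀ p m e → p * (m + e) + e ≡ p * m + suc p * e
      id = solve-∀
    id₁ : ∀ n k f a → n * k * (f * a) ≡ n * (f * a * k)
    id₁ = solve-∀
    id₂ : ∀ n a b → n * (a * b) ≡ a * (n * b)
    id₂ = solve-∀
    id₃ : ∀ a n → a * (n * n) ≡ n * (a * n)
    id₃ = solve-∀
    big : 2 * suc p * n < k * r⁷
    big = ≤-trans (*-monoʳ-< (2 * suc p) k-upper) (greedy-margin r≡ k k>0)

-- The extremal graph.

module Extremal {n : ℕ} (G : Graph n) (r : ℕ) {{nz : NonZero r}} where
  open Cliques G
  open Density G
  open Turan G
  open Residues r {{nz}}

  module _ (P : Pred n) (M : Majorant r P) where
    open Majorant M

    majorant≤D : sumOn P (class χ P) ≤ D P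
    majorant≤D = sumOn-mono P below

    τ≤majorant : τ (# P) ≤ sumOn P (class χ P)
    τ≤majorant = +-cancelʳ-≤ (r * (# P / r * (# P / r + 1))) _ _
      (≤-trans (≤-reflexive (τ-form (# P))) (class-squares r P χ bounded (# P / r)))

  -- `D all` ≤ `τ n` ≤ sum of squared class sizes ≤ `D all`, so all are equal: `tight` gives the
  -- multipartite structure and `class-squares-eq` the balance.
  extremal-iso : r ≤ n → cl (suc r) all ≡ 0 → D all ≤ τ n → G ≅ turán r {{nz}} n
  extremal-iso r≤n no-clique D≤ = Iso.iso G r r≤n χ (λ x → bounded x refl) adj-χ balanced (λ x y → proj₂ structure x y refl refl)
    where
    M = majorise r all no-clique
    open Majorant M
    D≤majorant : D all ≤ sumOn all (class χ all)
    D≤majorant = ≤-trans D≤ (≤-trans (≤-reflexive (cong τ (sym (#-all n)))) (τ≤majorant all M))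
    structure = tight λ x _ → ≤-reflexive (sym (trans (sym (+-identityʳ _)) (trans
      (sum-squeeze (λ x → 1 * class χ all x) (λ x → 1 * codeg all x) (λ x → *-monoʳ-≤ 1 (below x refl)) D≤majorant x) (+-identityʳ _))))
    adj-χ : ∀ x y → adj G x y ≡ not ⌊ χ x ≟ χ y ⌋
    adj-χ x y = trans (sym (not-involutive (adj G x y))) (cong not (proj₁ structure x y refl refl))
    balanced = class-squares-eq r all χ bounded (n / r) (≤-trans (+-monoˡ-≤ _ (≤-trans (majorant≤D all M) D≤))
      (≤-reflexive (trans (τ-form n) (cong ((n / r + n / r + 1) *_) (sym (#-all n))))))

-- The deletion process.

module Descent (p r n k : ℕ) (r≡ : r ≡ suc (suc p)) (r>0 : 0 < r) (nz : NonZero r)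
  (k-lower : r * r * (r * r) * k ≤ n) (k-upper : n < r * r * (r * r) * suc k) (r≤k : r ≤ k) (k≥3 : 3 ≤ k) (G : Graph n) where

  private
    r⁷ ℓ : ℕ
    r⁷ = r * r * r * (r * r * (r * r))
    ℓ  = r * r * k
    instance
      r≢0 : NonZero r
      r≢0 = nz

  open Cliques G
  open Density G
  open Subsets G
  open Turan G
  open Residues r {{nz}}
  open Extremal G r {{nz}}
  open FinalEstimates p r n k r≡ r>0 k-lower k-upper r≤k G

  ℓ<n : ℓ < n
  ℓ<n = ≤-trans (deletions-bound r≡ k k>0) k-lower

  k≤ℓ : k ≤ ℓ
  k≤ℓ = ≤-trans (≤-reflexive (sym (*-identityˡ k))) (*-monoˡ-≤ k (*-mono-≤ r>0 r>0))

  #>0 : ∀ {m i} → m + i ≡ n → i ≤ ℓ → 0 < m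
  #>0 {zero}  e i≤ℓ = ⊥-elim (<⇒≱ ℓ<n (≤-trans (≤-reflexive (sym e)) i≤ℓ))
  #>0 {suc m} e i≤ℓ = z<s

  -- The invariant times r gives a surplus m² - r D of at least 2 r³ k² - r². By `large` this
  -- reaches 2 (r - 1) r (k + 1)², which is what `finish` asks for, since n < r⁴ (k + 1).
  supersaturated-case : ∀ P → # P + ℓ ≡ n → D P + 2 * (ℓ * k) ≤ τ (# P) → Goal
  supersaturated-case P e inv = go (m≤n⇒∃[o]m+o≡n sparse)
    where
    m = # P
    deficit : r * (D P + 2 * (ℓ * k)) ≤ m * m + r * r
    deficit = ≤-trans (*-monoʳ-≤ r inv) (r*τ≤ m)
    k≤kk : k ≤ k * k
    k≤kk = ≤-trans (≤-reflexive (sym (*-identityʳ k))) (*-monoʳ-≤ k k>0)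
    -- The price of rounding n / r⁴ down; the inequality starts to hold at k = 3.
    k-square : suc k * suc k ≤ 2 * (k * k)
    k-square with m≤n⇒∃[o]m+o≡n k≥3
    ... | k′ , refl = cancel-≤ {x = 0} z≤n (≤-reflexive (id k′))
      where
      id : ∀ k → (4 + k) * (4 + k) + (2 + 4 * k + k * k) ≡ 2 * ((3 + k) * (3 + k)) + 0
      id = solve-∀
    large : 2 * suc p * (r * (suc k * suc k)) + r * r ≤ r * (2 * (ℓ * k))
    large = ≤-trans (+-mono-≤ (*-monoʳ-≤ (2 * suc p) (*-monoʳ-≤ r k-square)) (*-monoʳ-≤ r (≤-trans r≤k k≤kk)))
      (excess-margin r≡ k)
    sparse : r * D P ≤ m * m
    sparse = cancel-≤ (+-mono-≤ deficit (≤-trans (m≤n+m (r * r) _) large)) (≤-reflexive (id r (D P) (2 * (ℓ * k)) (m * m)))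
      where
      id : ∀ r d x s → r * d + (s + r * r + r * x) ≡ s + (r * (d + x) + r * r)
      id = solve-∀
    go : ∃[ E ] r * D P + E ≡ m * m → Goal
    go (E , eE) = finish E m
      (≤-trans (supersaturation p r r≡ P (suc p ! * js r G) E (#>0 e ≤-refl) (trans (+-comm E _) eE) through-edge)
        (*-monoʳ-≤ (r ^ p) (*-monoˡ-≤ (suc p ! * js r G) (≤-trans (m≤m+n m ℓ) (≤-reflexive e)))))
      (loss-bound m ℓ e ≤-refl)
      (≤-trans (*-monoʳ-< (2 * suc p) (*-mono-< k-upper k-upper))
        (≤-trans (≤-reflexive (id₁ (2 * suc p) r (suc k))) (*-monoˡ-≤ r⁷ excess)))
      where
      id₁ : ∀ a r s → a * (r * r * (r * r) * s * (r * r * (r * r) * s)) ≡ a * (r * (s * s)) * (r * r * r * (r * r * (r * r)))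
      id₁ = solve-∀
      excess : 2 * suc p * (r * (suc k * suc k)) ≤ E
      excess = cancel-≤ (+-mono-≤ large deficit) (≤-reflexive (trans
        (cong (λ s → 2 * suc p * (r * (suc k * suc k)) + (r * (2 * (ℓ * k)) + (s + r * r))) (sym eE))
        (id (2 * suc p * (r * (suc k * suc k))) r (2 * (ℓ * k)) (D P) E)))
        where
        id : ∀ a r x d E → a + (r * x + (r * d + E + r * r)) ≡ E + (a + r * r + r * (d + x))
        id = solve-∀

  Invariant : ℕ → Pred n → Set
  Invariant i P = # P + i ≡ n × D P + 2 * (i * k) ≤ τ (# P)

  step : ∀ i P → i ≤ ℓ → Invariant i P → Goal ⊎ (∃[ P′ ] Invariant (suc i) P′) ⊎ cl (suc r) P ≡ 0
  step i P i≤ℓ (e , inv) = go (# P) refl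
    where
    go : ∀ m → # P ≡ m → Goal ⊎ (∃[ P′ ] Invariant (suc i) P′) ⊎ cl (suc r) P ≡ 0
    go zero    em = ⊥-elim (<⇒≱ (#>0 (trans (cong (_+ i) (sym em)) e) i≤ℓ) z≤n)
    -- Deleting `v` lowers `D` by 2 `codeg P v` - 1 and `τ` by 2 (m / r) + 1, so codegree m / r + k
    -- + 1 gains exactly 2 k.
    go (suc m) em with any? (λ v → (P v ≟ᵇ true) ×-dec (suc (m / r + k) ≤? codeg P v))
    ... | yes (v , Pv , low) = inj₂ (inj₁ (delete v P , trans (+-suc m′ i) (trans (cong (_+ i) (sym (#-delete P v Pv))) e) ,
            cancel-≤ (+-mono-≤ (+-mono-≤ low low) (subst (λ s → D P + 2 * (i * k) ≤ τ s) em inv)) (≤-reflexive budget)))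
      where
      m′ = # (delete v P)
      d′ = D (delete v P)
      m′≡m : m′ ≡ m
      m′≡m = suc-injective (trans (sym (#-delete P v Pv)) em)
      budget : d′ + 2 * (suc i * k) + (codeg P v + codeg P v + τ (suc m)) ≡ τ m′ + (suc (m / r + k) + suc (m / r + k) + (D P + 2 * (i * k)))
      budget = trans (id₁ d′ (codeg P v) i k (τ m) (m / r)) (trans (cong (λ s → s + (2 * (suc i * k) + τ m + (m / r + m / r + 1))) (D-delete P v Pv G))
        (trans (id₂ (D P) i k (τ m) (m / r)) (cong (λ s → τ s + (suc (m / r + k) + suc (m / r + k) + (D P + 2 * (i * k)))) (sym m′≡m))))
        where
        id₁ : ∀ d c i k s q → d + 2 * (suc i * k) + (c + c + (s + (q + q + 1))) ≡ d + (c + c) + (2 * (suc i * k) + s + (q + q + 1))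
        id₁ = solve-∀
        id₂ : ∀ d i k s q → d + 1 + (2 * (suc i * k) + s + (q + q + 1)) ≡ s + (suc (q + k) + suc (q + k) + (d + 2 * (i * k)))
        id₂ = solve-∀
    ... | no none with cl (suc r) P in ec
    ...   | zero  = inj₂ (inj₂ refl)
    ...   | suc _ = inj₁ (pair-case (suc m) i P (m / r + k) em (trans (cong (_+ i) (sym em)) e) i≤ℓ
              (λ x Px → s≤s⁻¹ (≰⇒> λ le → none (x , Px , le))) slack (subst (0 <_) (sym ec) z<s))
      where
      slack : r * (m / r + k) ≤ suc m + r * k
      slack = ≤-trans (≤-reflexive (*-distribˡ-+ r (m / r) k)) (+-monoˡ-≤ (r * k)
        (≤-trans (≤-reflexive (*-comm r (m / r))) (≤-trans (m≤n+m _ (m % r)) (≤-trans (≤-reflexive (sym (m≡m%n+[m/n]*n m r))) (n≤1+n m)))))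

  -- `f` counts the deletions still allowed. The index `suc i` records that one has happened, so `D`
  -- is strictly below `τ` and the outcome without an (r + 1)-clique is contradictory.
  descend : ∀ f i P → f + suc i ≡ ℓ → Invariant (suc i) P → Goal
  descend zero    i P ef (e , inv) = supersaturated-case P (trans (cong (# P +_) (sym ef)) e) (subst (λ j → D P + 2 * (j * k) ≤ τ (# P)) ef inv)
  descend (suc f) i P ef (e , inv) with step (suc i) P (≤-trans (m≤n+m (suc i) (suc f)) (≤-reflexive ef)) (e , inv)
  ... | inj₁ goal = goal
  ... | inj₂ (inj₁ (P′ , inv′)) = descend f (suc i) P′ (trans (+-suc f (suc i)) ef) inv′
  ... | inj₂ (inj₂ no-clique) = ⊥-elim (<⇒≱ (≤-trans k>0 (m≤m+n k (i * k))) (≤-trans (m≤m+n (suc i * k) _) 2ik≤0))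
    where
    M = majorise r P no-clique
    2ik≤0 : 2 * (suc i * k) ≤ 0
    2ik≤0 = +-cancelˡ-≤ (D P) _ _ (≤-trans inv (≤-trans (≤-trans (τ≤majorant P M) (majorant≤D P M)) (≤-reflexive (sym (+-identityʳ (D P))))))

  main : D all ≤ τ n → ¬ (G ≅ turán r {{nz}} n) → Goal
  main D≤ not-turán with step 0 all z≤n (trans (+-identityʳ _) (#-all n) , ≤-trans (≤-reflexive (+-identityʳ _)) (≤-trans D≤ (≤-reflexive (cong τ (sym (#-all n))))))
  ... | inj₁ goal = goal
  ... | inj₂ (inj₁ (P′ , inv′)) = descend (pred ℓ) 0 P′ (trans (+-comm (pred ℓ) 1) (suc-pred ℓ {{>-nonZero (≤-trans k>0 k≤ℓ)}})) inv′
  ... | inj₂ (inj₂ no-clique) = ⊥-elim (not-turán (extremal-iso r≤n no-clique D≤))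
    where
    r≤n : r ≤ n
    r≤n = ≤-trans r≤k (≤-trans k≤ℓ (<⇒≤ ℓ<n))

theorem7 : (r : ℕ) → 2 ≤ r → (n : ℕ) → r ^ 8 < n →
    (nz : NonZero r) → (G : Graph n) → t r {{nz}} n ≤ e G →
    ¬ (G ≅ turán r {{nz}} n) →
    n ^ (r ∸ 1) < js r G * r ^ (r + 5)
theorem7 r 2≤r n r⁸<n nz G t≤e not-turán with m≤n⇒∃[o]m+o≡n 2≤r
... | p , 2+p≡r = subst₂ (λ x y → n ^ x < js r G * y) (cong (_∸ 1) 2+p≡r) powers
  (Descent.main p r n k (sym 2+p≡r) r>0 nz k-lower k-upper r≤k k≥3 G (D≤τ r {{nz}} n G t≤e) not-turán)
  where
  r>0 : 0 < r
  r>0 = ≤-trans (s≤s z≤n) 2≤r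
  R k : ℕ
  R = r * r * (r * r)
  instance
    r≢0 : NonZero r
    r≢0 = >-nonZero r>0
    rr≢0 : NonZero (r * r)
    rr≢0 = m*n≢0 r r
    R≢0 : NonZero R
    R≢0 = m*n≢0 (r * r) (r * r)
  k = n / R
  k-lower : R * k ≤ n
  k-lower = ≤-trans (≤-reflexive (*-comm R k)) (≤-trans (m≤n+m _ (n % R)) (≤-reflexive (sym (m≡m%n+[m/n]*n n R))))
  k-upper : n < R * suc k
  k-upper = ≤-trans (s≤s (≤-reflexive (m≡m%n+[m/n]*n n R))) (≤-trans (+-monoˡ-≤ (k * R) (m%n<n n R)) (≤-reflexive (*-comm (suc k) R)))
  -- r⁸ is `R * R`, so n > r⁸ forces r⁴ ≤ k; from this and r ≥ 2 follow r ≤ k and 3 ≤ k.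
  R≤k : R ≤ k
  R≤k = s≤s⁻¹ (*-cancelˡ-< R _ _ (≤-trans (≤-trans (≤-reflexive (cong suc (id r))) r⁸<n) (<⇒≤ k-upper)))
    where
    id : ∀ r → r * r * (r * r) * (r * r * (r * r)) ≡ r * (r * (r * (r * (r * (r * (r * (r * 1)))))))
    id = solve-∀
  r≤k : r ≤ k
  r≤k = ≤-trans (≤-trans (m≤m*n r r) (m≤m*n (r * r) (r * r))) R≤k
  k≥3 : 3 ≤ k
  k≥3 = ≤-trans (≤-trans (s≤s (s≤s (s≤s z≤n))) (*-mono-≤ (*-mono-≤ 2≤r 2≤r) (*-mono-≤ 2≤r 2≤r))) R≤k
  powers : r ^ p * (r * r * r * (r * r * (r * r))) ≡ r ^ (r + 5)
  powers = trans (cong (r ^ p *_) (id r)) (trans (sym (^-distribˡ-+-* r p 7)) (cong (r ^_)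
    (trans (trans (+-suc p 6) (cong suc (+-suc p 5))) (cong (_+ 5) 2+p≡r))))
    where
    id : ∀ r → r * r * r * (r * r * (r * r)) ≡ r * (r * (r * (r * (r * (r * (r * 1))))))
    id = solve-∀
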